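{- Let $A$ and $B$ be finite non-collinear sets in $\mathbb{R}^2$ with $i_A=i_B=1$. Then $$\sqrt{2i_{A+B}+b_{A+B}-2}\geq \sqrt{2i_A+b_A-2}+\sqrt{2i_B+b_B-2},$$ equivalently $\mathrm{tr}(A+B)^{1/2}\geq \mathrm{tr}(A)^{1/2}+\mathrm{tr}(B)^{1/2}$.
   Context: $A+B=\{a+b:a\in A,\ b\in B\}$; $[X]$ is the convex hull of $X$. For a finite non-collinear set $C\subset\mathbb{R}^2$, $b_C$ and $i_C$ denote the number of points of $C$ on the boundary $\partial[C]$ and in the interior of $[C]$, respectively, and $\mathrm{tr}(C)$ denotes the common number of triangles in any triangulation of $[C]$ using the points of $C$ as vertices; one has $\mathrm{tr}(C)=b_C+2i_C-2$. -}

module Defs where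

open import Level using (0ℓ)
open import Data.Nat using (ℕ; zero; suc)
open import Data.Fin using (Fin)
open import Data.Product using (Σ; ∃; _×_; _,_)
open import Data.Sum using (_⊎_)
open import Data.List using (List; length)
open import Data.List.Membership.Propositional using (_∈_)
open import Data.List.Relation.Unary.Unique.Propositional using (Unique)
open import Relation.Binary.PropositionalEquality using (_≡_)
open import Relation.Binary.Definitions using (Trichotomous)
open import Relation.Nullary using (¬_)
open import Algebra.Structures using (IsCommutativeRing)

-- Axiomatic real numbers: a Dedekind-complete (least-upper-bound)
-- ordered field.  Every model is isomorphic to ℝ, so quantifying over
-- all models is the same as talking about ℝ.

record RealField : Set₁ where
  infixl 6 _+_ _-_
  infixl 7 _*_
  infix 4 _<_ _≤_
  field
    Carrier : Set
    _+_ _*_ : Carrier → Carrier → Carrier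
    -_      : Carrier → Carrier
    0# 1#   : Carrier
    _<_     : Carrier → Carrier → Set
    isCommutativeRing : IsCommutativeRing _≡_ _+_ _*_ -_ 0# 1#
    0≢1     : ¬ (0# ≡ 1#)
    inverse : ∀ x → ¬ (x ≡ 0#) → Σ Carrier (λ y → x * y ≡ 1#)
    <-trans : ∀ {x y z} → x < y → y < z → x < z
    <-tri   : Trichotomous _≡_ _<_
    +-mono-< : ∀ {x y} z → x < y → x + z < y + z
    *-pos   : ∀ {x y} → 0# < x → 0# < y → 0# < x * y
  _≤_ : Carrier → Carrier → Set
  x ≤ y = (x < y) ⊎ (x ≡ y)
  _-_ : Carrier → Carrier → Carrier
  x - y = x + (- y)
  IsUpperBound : (Carrier → Set) → Carrier → Set
  IsUpperBound S u = ∀ x → S x → x ≤ u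
  field
    lub : (S : Carrier → Set) → ∃ S → ∃ (IsUpperBound S) →
          Σ Carrier (λ s → IsUpperBound S s × (∀ u → IsUpperBound S u → s ≤ u))

module Plane (ℝ : RealField) where
  open RealField ℝ

  Point : Set
  Point = Carrier × Carrier

  _⊕_ : Point → Point → Point
  (x₁ , y₁) ⊕ (x₂ , y₂) = (x₁ + x₂ , y₁ + y₂)

  -- finite sets of points: given by a list (the set is its set of members)
  FinSet : Set
  FinSet = List Point

  _∈Sum_,_ : Point → FinSet → FinSet → Set
  p ∈Sum A , B = Σ Point (λ a → Σ Point (λ b → a ∈ A × b ∈ B × p ≡ a ⊕ b))

  ΣF : ∀ {n} → (Fin n → Carrier) → Carrier
  ΣF {zero}  f = 0#
  ΣF {suc n} f = f Fin.zero + ΣF (λ i → f (Fin.suc i))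

  InHull : (Point → Set) → Point → Set
  InHull C p =
    Σ ℕ λ n → Σ (Fin n → Point) λ q → Σ (Fin n → Carrier) λ w →
      (∀ i → C (q i)) × (∀ i → 0# ≤ w i) × (ΣF w ≡ 1#) ×
      (ΣF (λ i → w i * Data.Product.proj₁ (q i)) ≡ Data.Product.proj₁ p) ×
      (ΣF (λ i → w i * Data.Product.proj₂ (q i)) ≡ Data.Product.proj₂ p)

  InInterior : (Point → Set) → Point → Set
  InInterior C (x , y) =
    Σ Carrier λ ε → (0# < ε) ×
      (∀ x' y' → (- ε < x' - x) → (x' - x < ε) → (- ε < y' - y) → (y' - y < ε) →
        InHull C (x' , y'))

  -- p lies on the boundary ∂[C] = [C] minus its interior ([C] is closed)
  OnBoundary : (Point → Set) → Point → Set
  OnBoundary C p = InHull C p × ¬ InInterior C p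

  Collinear : (Point → Set) → Set
  Collinear C = Σ Carrier λ a → Σ Carrier λ b → Σ Carrier λ c →
    ¬ (a ≡ 0# × b ≡ 0#) × (∀ x y → C (x , y) → a * x + b * y ≡ c)

  HasCard : (Point → Set) → ℕ → Set
  HasCard P n = Σ (List Point) λ xs →
    Unique xs × (∀ p → (p ∈ xs → P p) × (P p → p ∈ xs)) × length xs ≡ n

  bEq : (Point → Set) → ℕ → Set
  bEq C n = HasCard (λ p → C p × OnBoundary C p) n

  iEq : (Point → Set) → ℕ → Set
  iEq C n = HasCard (λ p → C p × InInterior C p) n

  fromℕ : ℕ → Carrier
  fromℕ zero    = 0#
  fromℕ (suc n) = 1# + fromℕ n

  IsSqrt : Carrier → ℕ → Set
  IsSqrt s m = 0# ≤ s × s * s ≡ fromℕ m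

{-# OPTIONS --safe #-}

-- Since i_A = i_B = 1, the claim is √(2 i_S + b_S − 2) ≥ √b_A + √b_B for S = A + B.
-- If a₀ and b₀ are the interior points, then A + b₀ and a₀ + B lie in the interior of [S], so
-- i_S ≥ 1 + max(b_A, b_B).  Moreover b_S ≥ b_A + b_B: send a boundary point a of A, followed
-- counterclockwise on ∂[A] by a side of direction u, to a + (first point of B on its face of
-- direction u), and a boundary point b of B, similarly, to (last point of A on its face) + b.
-- This is injective, as a point of ∂[S] determines the direction of the side that follows it.
-- Hence 2 i_S + b_S − 2 ≥ b_A + b_B + 2 max(b_A, b_B) ≥ (√b_A + √b_B)².

module Submission where

open import Defs
open import Algebra.Bundles using (CommutativeRing)
import Algebra.Properties.AbelianGroup
import Algebra.Properties.Ring
import Algebra.Properties.Semiring.Mult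
import Algebra.Solver.Ring
open import Algebra.Solver.Ring.AlmostCommutativeRing using (fromCommutativeRing; _-Raw-AlmostCommutative⟶_)
open import Data.Empty using (⊥; ⊥-elim)
open import Data.Fin using (Fin; zero; suc)
open import Data.Fin.Properties using (injective⇒≤)
open import Data.Integer using (ℤ; +_; -[1+_]; _⊖_)
import Data.Integer as ℤ
import Data.Integer.Properties as ℤₚ
open import Data.List using (List; []; _∷_; map; _++_; length; lookup)
open import Data.List.Membership.Propositional using (_∈_; find)
open import Data.List.Membership.Propositional.Properties using (∈-map⁺; ∈-map⁻; ∈-lookup; ∈-++⁻)
open import Data.List.Properties using (length-++; length-map)
open import Data.List.Relation.Unary.All using (All; []; _∷_)
import Data.List.Relation.Unary.All as All
open import Data.List.Relation.Unary.AllPairs using (_∷_)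
open import Data.List.Relation.Unary.Any using (here; there; index)
open import Data.List.Relation.Unary.Any.Properties using (lookup-index)
open import Data.List.Relation.Unary.Unique.Propositional using (Unique)
import Data.List.Relation.Unary.Unique.Propositional.Properties as Unique
open import Data.Maybe using (Maybe; just; nothing)
open import Data.Nat using (ℕ; zero; suc; _∸_) renaming (_+_ to _+ℕ_; _*_ to _*ℕ_; _≤_ to _≤ℕ_)
import Data.Nat.Properties as ℕₚ
import Data.Nat.Solver as ℕSolver
open import Data.Product using (Σ; ∃; _×_; _,_; proj₁; proj₂)
open import Data.Sum using (_⊎_; inj₁; inj₂)
open import Data.Sum.Properties using (inj₁-injective; inj₂-injective)
open import Relation.Binary.Definitions using (tri<; tri≈; tri>)
open import Relation.Binary.PropositionalEquality using (_≡_; refl; sym; trans; cong; cong₂; subst; subst₂; module ≡-Reasoning)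
open import Relation.Nullary using (¬_; yes; no)

-- The hull is given by convex combinations and the boundary by its non-interior points, so there is
-- no polygon with ordered vertices to walk along. The side that follows a boundary point `a` has to
-- be extracted from the differences `r ⊝ a`: for a non-collinear set either they positively span
-- the plane, and `a` is interior, or one of them, `u`, has all of them weakly to its left. Such a
-- `u` is determined only up to a positive factor, so the first and last points of a face must be
-- insensitive to rescaling `u`. Taking the first point in B but the last in A keeps the two
-- families apart on parallel sides: the edge at `a` reaches on to `a ⊕ u`, so `a` is never the last
-- point of its own face.

-- Ring identities with integer coefficients

module IntegerSolver {c ℓ} (R : CommutativeRing c ℓ) where
  private module R = CommutativeRing R
  open R using (_≈_; 0#; 1#; +-congˡ; +-congʳ; -‿cong)
  open Algebra.Properties.Ring R.ring using (-0#≈0#; -‿involutive; -‿distribˡ-*; -‿distribʳ-*)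
  open Algebra.Properties.AbelianGroup R.+-abelianGroup using (⁻¹-∙-comm)
  open Algebra.Properties.Semiring.Mult R.semiring using (×-homo-+; ×1-homo-*) renaming (_×_ to _·_)
  open import Relation.Binary.Reasoning.Setoid R.setoid

  -- Coefficients live in ℤ because equality there is decided by evaluation, while the operations of
  -- an axiomatic field do not reduce and cancellations between coefficients would go unseen.
  ⟦_⟧ : ℤ → R.Carrier
  ⟦ + n ⟧      = n · 1#
  ⟦ -[1+ n ] ⟧ = R.- (suc n · 1#)

  cong-⟦⟧ : ∀ {i j} → i ≡ j → ⟦ i ⟧ ≈ ⟦ j ⟧
  cong-⟦⟧ refl = R.refl

  ⟦⟧-homo-⊖ : ∀ m n → ⟦ m ⊖ n ⟧ ≈ m · 1# R.- n · 1#
  ⟦⟧-homo-⊖ zero    zero    = R.sym (R.-‿inverseʳ 0#)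
  ⟦⟧-homo-⊖ zero    (suc n) = R.sym (R.+-identityˡ _)
  ⟦⟧-homo-⊖ (suc m) zero    = R.sym (R.trans (+-congˡ -0#≈0#) (R.+-identityʳ _))
  ⟦⟧-homo-⊖ (suc m) (suc n) = begin
    ⟦ suc m ⊖ suc n ⟧                         ≈⟨ cong-⟦⟧ (ℤₚ.[1+m]⊖[1+n]≡m⊖n m n) ⟩
    ⟦ m ⊖ n ⟧                                 ≈⟨ ⟦⟧-homo-⊖ m n ⟩
    M R.- N                                   ≈⟨ +-congʳ (R.+-identityˡ M) ⟨
    (0# R.+ M) R.- N                          ≈⟨ +-congʳ (+-congʳ (R.-‿inverseʳ 1#)) ⟨
    ((1# R.- 1#) R.+ M) R.- N                 ≈⟨ +-congʳ (R.+-assoc _ _ _) ⟩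
    (1# R.+ (R.- 1# R.+ M)) R.- N             ≈⟨ +-congʳ (+-congˡ (R.+-comm _ _)) ⟩
    (1# R.+ (M R.- 1#)) R.- N                 ≈⟨ +-congʳ (R.+-assoc _ _ _) ⟨
    ((1# R.+ M) R.- 1#) R.- N                 ≈⟨ R.+-assoc _ _ _ ⟩
    (1# R.+ M) R.+ (R.- 1# R.- N)             ≈⟨ +-congˡ (⁻¹-∙-comm _ _) ⟩
    (1# R.+ M) R.- (1# R.+ N)                 ∎
    where
    M N : R.Carrier
    M = m · 1#
    N = n · 1#

  ⟦⟧-homo-+ : ∀ i j → ⟦ i ℤ.+ j ⟧ ≈ ⟦ i ⟧ R.+ ⟦ j ⟧
  ⟦⟧-homo-+ (+ m)      (+ n)      = ×-homo-+ 1# m n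
  ⟦⟧-homo-+ (+ m)      -[1+ n ]   = ⟦⟧-homo-⊖ m (suc n)
  ⟦⟧-homo-+ -[1+ m ]   (+ n)      = R.trans (⟦⟧-homo-⊖ n (suc m)) (R.+-comm _ _)
  ⟦⟧-homo-+ i@(-[1+ m ]) j@(-[1+ n ]) = begin
    ⟦ i ℤ.+ j ⟧                            ≈⟨ cong-⟦⟧ (ℤₚ.neg-distrib-+ (+ suc m) (+ suc n)) ⟨
    ⟦ ℤ.- (+ (suc m +ℕ suc n)) ⟧           ≡⟨⟩
    R.- ((suc m +ℕ suc n) · 1#)            ≈⟨ -‿cong (×-homo-+ 1# (suc m) (suc n)) ⟩
    R.- (suc m · 1# R.+ suc n · 1#)        ≈⟨ ⁻¹-∙-comm _ _ ⟨
    ⟦ i ⟧ R.+ ⟦ j ⟧                        ∎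

  ⟦⟧-homo-- : ∀ i → ⟦ ℤ.- i ⟧ ≈ R.- ⟦ i ⟧
  ⟦⟧-homo-- (+ zero)   = R.sym -0#≈0#
  ⟦⟧-homo-- (+ suc n)  = R.refl
  ⟦⟧-homo-- -[1+ n ]   = R.sym (-‿involutive _)

  ⟦⟧-homo-pos* : ∀ m j → ⟦ + m ℤ.* j ⟧ ≈ m · 1# R.* ⟦ j ⟧
  ⟦⟧-homo-pos* m (+ n)    = R.trans (cong-⟦⟧ (sym (ℤₚ.pos-* m n))) (×1-homo-* m n)
  ⟦⟧-homo-pos* m -[1+ n ] = begin
    ⟦ + m ℤ.* -[1+ n ] ⟧          ≈⟨ cong-⟦⟧ (ℤₚ.neg-distribʳ-* (+ m) (+ suc n)) ⟨
    ⟦ ℤ.- (+ m ℤ.* + suc n) ⟧     ≈⟨ ⟦⟧-homo-- (+ m ℤ.* + suc n) ⟩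
    R.- ⟦ + m ℤ.* + suc n ⟧       ≈⟨ -‿cong (⟦⟧-homo-pos* m (+ suc n)) ⟩
    R.- (m · 1# R.* ⟦ + suc n ⟧)  ≈⟨ -‿distribʳ-* _ _ ⟩
    m · 1# R.* ⟦ -[1+ n ] ⟧       ∎

  ⟦⟧-homo-* : ∀ i j → ⟦ i ℤ.* j ⟧ ≈ ⟦ i ⟧ R.* ⟦ j ⟧
  ⟦⟧-homo-* (+ m)    j = ⟦⟧-homo-pos* m j
  ⟦⟧-homo-* -[1+ m ] j = begin
    ⟦ -[1+ m ] ℤ.* j ⟧            ≈⟨ cong-⟦⟧ (ℤₚ.neg-distribˡ-* (+ suc m) j) ⟨
    ⟦ ℤ.- (+ suc m ℤ.* j) ⟧       ≈⟨ ⟦⟧-homo-- (+ suc m ℤ.* j) ⟩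
    R.- ⟦ + suc m ℤ.* j ⟧         ≈⟨ -‿cong (⟦⟧-homo-pos* (suc m) j) ⟩
    R.- (suc m · 1# R.* ⟦ j ⟧)    ≈⟨ -‿distribˡ-* _ _ ⟩
    ⟦ -[1+ m ] ⟧ R.* ⟦ j ⟧        ∎

  morphism : ℤ.+-*-rawRing -Raw-AlmostCommutative⟶ fromCommutativeRing R
  morphism = record
    { ⟦_⟧ = ⟦_⟧ ; +-homo = ⟦⟧-homo-+ ; *-homo = ⟦⟧-homo-* ; -‿homo = ⟦⟧-homo--
    ; 0-homo = R.refl ; 1-homo = R.+-identityʳ 1# }

  _≟⟦⟧_ : ∀ i j → Maybe (⟦ i ⟧ ≈ ⟦ j ⟧)
  i ≟⟦⟧ j with i ℤ.≟ j
  ... | yes i≡j = just (cong-⟦⟧ i≡j)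
  ... | no _    = nothing

  open Algebra.Solver.Ring ℤ.+-*-rawRing (fromCommutativeRing R) morphism _≟⟦⟧_ public
    using (solve; _:=_; _:+_; _:*_; _:-_; :-_; con; Polynomial)

-- Counting by injective relations

lookup-injective : ∀ {a} {X : Set a} {xs : List X} → Unique xs →
  ∀ i j → lookup xs i ≡ lookup xs j → i ≡ j
lookup-injective (x∉ ∷ u) zero    zero    eq = refl
lookup-injective (x∉ ∷ u) zero    (suc j) eq = ⊥-elim (All.lookup x∉ (∈-lookup j) eq)
lookup-injective (x∉ ∷ u) (suc i) zero    eq = ⊥-elim (All.lookup x∉ (∈-lookup i) (sym eq))
lookup-injective (x∉ ∷ u) (suc i) (suc j) eq = cong suc (lookup-injective u i j eq)

-- A relation replaces a function because the image of a point is chosen from its membership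
-- evidence; it is enough that the image determines the point. `f` sends positions to positions.
pigeonhole : ∀ {a b r} {X : Set a} {Y : Set b} (R : X → Y → Set r) {xs : List X} {ys : List Y} →
  Unique xs → (∀ {x} → x ∈ xs → ∃ λ y → y ∈ ys × R x y) →
  (∀ {x x′ y} → R x y → R x′ y → x ≡ x′) → length xs ≤ℕ length ys
pigeonhole R {xs} {ys} unique image injective = injective⇒≤ {f = f} λ {i} {j} fi≡fj →
  lookup-injective unique i j (injective (related i)
    (subst (R (lookup xs j)) (cong (lookup ys) (sym fi≡fj)) (related j)))
  where
  f : Fin (length xs) → Fin (length ys)
  f i = index (proj₁ (proj₂ (image (∈-lookup i))))
  related : ∀ i → R (lookup xs i) (lookup ys (f i))
  related i = let (_ , y∈ , xRy) = image (∈-lookup i) in subst (R (lookup xs i)) (lookup-index y∈) xRy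

-- Ordered field arithmetic

module OrderedField (ℝ : RealField) where
  open RealField ℝ

  commutativeRing : CommutativeRing _ _
  commutativeRing = record { isCommutativeRing = isCommutativeRing }

  open IntegerSolver commutativeRing public

  open import Algebra.Properties.Ring (CommutativeRing.ring commutativeRing) public
    using (-0#≈0#) renaming (-‿involutive to neg-involutive)
  open CommutativeRing commutativeRing public
    using (+-identityˡ; +-identityʳ; -‿inverseʳ; zeroˡ; zeroʳ; *-identityˡ; *-identityʳ; distribʳ; +-comm; +-assoc)

  x<0⇒0<-x : ∀ {x} → x < 0# → 0# < - x
  x<0⇒0<-x {x} x<0 = subst₂ _<_ (-‿inverseʳ x) (+-identityˡ (- x)) (+-mono-< (- x) x<0)

  0<x⇒-x<0 : ∀ {x} → 0# < x → - x < 0#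
  0<x⇒-x<0 {x} 0<x = subst₂ _<_ (+-identityˡ (- x)) (-‿inverseʳ x) (+-mono-< (- x) 0<x)

  <⇒0<- : ∀ {x y} → x < y → 0# < y - x
  <⇒0<- {x} {y} x<y = subst (_< y - x) (-‿inverseʳ x) (+-mono-< (- x) x<y)

  0<-⇒< : ∀ {x y} → 0# < y - x → x < y
  0<-⇒< {x} {y} 0<y-x = subst₂ _<_ (+-identityˡ x)
    (solve 2 (λ x y → (y :- x) :+ x := y) refl x y) (+-mono-< x 0<y-x)

  0≤-⇒≤ : ∀ {x y} → 0# ≤ y - x → x ≤ y
  0≤-⇒≤         (inj₁ 0<y-x) = inj₁ (0<-⇒< 0<y-x)
  0≤-⇒≤ {x} {y} (inj₂ 0≡y-x) = inj₂ (trans (sym (+-identityˡ x))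
    (trans (cong (_+ x) 0≡y-x) (solve 2 (λ x y → (y :- x) :+ x := y) refl x y)))

  <-irrefl : ∀ {x} → ¬ x < x
  <-irrefl {x} x<x with <-tri x x
  ... | tri< _ x≢x _ = x≢x refl
  ... | tri≈ x≮x _ _ = x≮x x<x
  ... | tri> _ x≢x _ = x≢x refl

  pos-neg-⊥ : ∀ {x} → 0# < x → 0# < - x → ⊥
  pos-neg-⊥ 0<x 0<-x = <-irrefl (<-trans 0<-x (0<x⇒-x<0 0<x))

  pos⇒≢0 : ∀ {x} → 0# < x → ¬ x ≡ 0#
  pos⇒≢0 0<x refl = <-irrefl 0<x

  nonneg-neg-⊥ : ∀ {x} → 0# ≤ x → 0# < - x → ⊥
  nonneg-neg-⊥     (inj₁ 0<x)  0<-x = pos-neg-⊥ 0<x 0<-x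
  nonneg-neg-⊥     (inj₂ refl) 0<-x = <-irrefl (subst (0# <_) -0#≈0# 0<-x)

  nonneg-antisym : ∀ {x} → 0# ≤ x → 0# ≤ - x → x ≡ 0#
  nonneg-antisym (inj₂ 0≡x) _          = sym 0≡x
  nonneg-antisym (inj₁ 0<x) (inj₁ 0<-x) = ⊥-elim (pos-neg-⊥ 0<x 0<-x)
  nonneg-antisym {x} (inj₁ 0<x) (inj₂ 0≡-x) = trans (sym (neg-involutive x))
    (trans (cong -_ (sym 0≡-x)) -0#≈0#)

  +-pos : ∀ {x y} → 0# < x → 0# < y → 0# < x + y
  +-pos {x} {y} 0<x 0<y = <-trans 0<y (subst (_< x + y) (+-identityˡ y) (+-mono-< y 0<x))

  +-pos-nonneg : ∀ {x y} → 0# < x → 0# ≤ y → 0# < x + y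
  +-pos-nonneg     0<x (inj₁ 0<y)  = +-pos 0<x 0<y
  +-pos-nonneg {x} 0<x (inj₂ refl) = subst (0# <_) (sym (+-identityʳ x)) 0<x

  +-nonneg-pos : ∀ {x y} → 0# ≤ x → 0# < y → 0# < x + y
  +-nonneg-pos {x} {y} 0≤x 0<y = subst (0# <_) (+-comm y x) (+-pos-nonneg 0<y 0≤x)

  +-nonneg : ∀ {x y} → 0# ≤ x → 0# ≤ y → 0# ≤ x + y
  +-nonneg         (inj₁ 0<x)  0≤y = inj₁ (+-pos-nonneg 0<x 0≤y)
  +-nonneg {y = y} (inj₂ refl) 0≤y = subst (0# ≤_) (sym (+-identityˡ y)) 0≤y

  *-nonneg : ∀ {x y} → 0# ≤ x → 0# ≤ y → 0# ≤ x * y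
  *-nonneg         (inj₁ 0<x)  (inj₁ 0<y)  = inj₁ (*-pos 0<x 0<y)
  *-nonneg {x}     (inj₁ 0<x)  (inj₂ refl) = inj₂ (sym (zeroʳ x))
  *-nonneg {y = y} (inj₂ refl) _           = inj₂ (sym (zeroˡ y))

  pos-zero-neg : ∀ x → 0# < x ⊎ x ≡ 0# ⊎ 0# < - x
  pos-zero-neg x with <-tri 0# x
  ... | tri< 0<x _ _ = inj₁ 0<x
  ... | tri≈ _ 0≡x _ = inj₂ (inj₁ (sym 0≡x))
  ... | tri> _ _ x<0 = inj₂ (inj₂ (x<0⇒0<-x x<0))

  zero-nonzero : ∀ x → x ≡ 0# ⊎ ¬ x ≡ 0#
  zero-nonzero x with <-tri x 0#
  ... | tri< _ x≢0 _ = inj₂ x≢0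
  ... | tri≈ _ x≡0 _ = inj₁ x≡0
  ... | tri> _ x≢0 _ = inj₂ x≢0

  nonneg-neg : ∀ x → 0# ≤ x ⊎ 0# < - x
  nonneg-neg x with pos-zero-neg x
  ... | inj₁ 0<x         = inj₁ (inj₁ 0<x)
  ... | inj₂ (inj₁ x≡0)  = inj₁ (inj₂ (sym x≡0))
  ... | inj₂ (inj₂ 0<-x) = inj₂ 0<-x

  pos-nonpos : ∀ x → 0# < x ⊎ 0# ≤ - x
  pos-nonpos x with nonneg-neg (- x)
  ... | inj₁ 0≤-x = inj₂ 0≤-x
  ... | inj₂ 0<x  = inj₁ (subst (0# <_) (neg-involutive x) 0<x)

  *-cancelˡ-pos : ∀ {x y} → 0# < x → 0# < x * y → 0# < y
  *-cancelˡ-pos {x} {y} 0<x 0<xy with pos-nonpos y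
  ... | inj₁ 0<y  = 0<y
  ... | inj₂ 0≤-y = ⊥-elim (nonneg-neg-⊥ (*-nonneg (inj₁ 0<x) 0≤-y)
    (subst (0# <_) (solve 2 (λ x y → x :* y := :- (x :* (:- y))) refl x y) 0<xy))

  *-cancelˡ-nonneg : ∀ {x y} → 0# < x → 0# ≤ x * y → 0# ≤ y
  *-cancelˡ-nonneg {x} {y} 0<x 0≤xy with nonneg-neg y
  ... | inj₁ 0≤y  = 0≤y
  ... | inj₂ 0<-y = ⊥-elim (nonneg-neg-⊥ 0≤xy
    (subst (0# <_) (solve 2 (λ x y → x :* (:- y) := :- (x :* y)) refl x y) (*-pos 0<x 0<-y)))

  *-cancelˡ-zero : ∀ {x y} → ¬ x ≡ 0# → x * y ≡ 0# → y ≡ 0#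
  *-cancelˡ-zero {x} {y} x≢0 xy≡0 = let (k , xk≡1) = inverse x x≢0 in begin
    y             ≡⟨ *-identityˡ y ⟨
    1# * y        ≡⟨ cong (_* y) xk≡1 ⟨
    x * k * y     ≡⟨ solve 3 (λ x y k → x :* k :* y := x :* y :* k) refl x y k ⟩
    x * y * k     ≡⟨ cong (_* k) xy≡0 ⟩
    0# * k        ≡⟨ zeroˡ k ⟩
    0#            ∎
    where open ≡-Reasoning

  square-nonneg : ∀ x → 0# ≤ x * x
  square-nonneg x with nonneg-neg x
  ... | inj₁ 0≤x  = *-nonneg 0≤x 0≤x
  ... | inj₂ 0<-x = inj₁ (subst (0# <_) (solve 1 (λ x → (:- x) :* (:- x) := x :* x) refl x) (*-pos 0<-x 0<-x))

  0<1 : 0# < 1#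
  0<1 with subst (0# ≤_) (*-identityʳ 1#) (square-nonneg 1#)
  ... | inj₁ 0<1 = 0<1
  ... | inj₂ 0≡1 = ⊥-elim (0≢1 0≡1)

  square-pos : ∀ {x} → ¬ x ≡ 0# → 0# < x * x
  square-pos {x} x≢0 with square-nonneg x
  ... | inj₁ 0<xx = 0<xx
  ... | inj₂ 0≡xx = ⊥-elim (x≢0 (*-cancelˡ-zero x≢0 (sym 0≡xx)))

  inverse-pos : ∀ {x} → 0# < x → Σ Carrier λ k → x * k ≡ 1# × 0# < k
  inverse-pos 0<x = let (k , xk≡1) = inverse _ (pos⇒≢0 0<x) in
    k , xk≡1 , *-cancelˡ-pos 0<x (subst (0# <_) (sym xk≡1) 0<1)

  -- The witness is `d` divided by `1# + N`: a radius whose `N`-fold error still leaves a margin of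
  -- `ε` below `d`.
  split-pos : ∀ {d N} → 0# < d → 0# ≤ N → Σ Carrier λ ε → 0# < ε × d ≡ ε + ε * N
  split-pos {d} {N} 0<d 0≤N = let (k , Nk≡1 , 0<k) = inverse-pos (+-pos-nonneg 0<1 0≤N) in
    d * k , *-pos 0<d 0<k , (begin
      d                         ≡⟨ *-identityʳ d ⟨
      d * 1#                    ≡⟨ cong (d *_) Nk≡1 ⟨
      d * ((1# + N) * k)        ≡⟨ solve 4 (λ d k N one → d :* ((one :+ N) :* k) := one :* (d :* k) :+ d :* k :* N)
                                     refl d k N 1# ⟩
      1# * (d * k) + d * k * N  ≡⟨ cong (λ t → t + d * k * N) (*-identityˡ (d * k)) ⟩
      d * k + d * k * N         ∎)
    where open ≡-Reasoning

  0<2 : 0# < 1# + 1#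
  0<2 = +-pos 0<1 0<1

  double : ∀ x → x + x ≡ (1# + 1#) * x
  double x = sym (trans (distribʳ x 1# 1#) (cong₂ _+_ (*-identityˡ x) (*-identityˡ x)))

  ∃-abs-bound : ∀ c → Σ Carrier λ M → 0# ≤ M × 0# ≤ M - c × 0# ≤ M + c
  ∃-abs-bound c with nonneg-neg c
  ... | inj₁ 0≤c  = c , 0≤c , inj₂ (sym (-‿inverseʳ c)) , +-nonneg 0≤c 0≤c
  ... | inj₂ 0<-c = - c , inj₁ 0<-c , inj₁ (+-pos 0<-c 0<-c) ,
    inj₂ (solve 1 (λ c → con (+ 0) := (:- c) :+ c) refl c)

-- Cross and dot products in the plane

module ConvexPlane (ℝ : RealField) where
  open RealField ℝ
  open OrderedField ℝ
  open Plane ℝ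

  infixl 6 _⊝_

  _⊝_ : Point → Point → Point
  p ⊝ q = proj₁ p - proj₁ q , proj₂ p - proj₂ q

  O : Point
  O = 0# , 0#

  cross dot : Point → Point → Carrier
  cross u v = proj₁ u * proj₂ v - proj₂ u * proj₁ v
  dot   u v = proj₁ u * proj₁ v + proj₂ u * proj₂ v

  private
    X : ∀ {n} (a b c d : Polynomial n) → Polynomial n
    X a b c d = a :* d :- b :* c

  cross-antisym : ∀ u v → - cross u v ≡ cross v u
  cross-antisym (a , b) (c , d) = solve 4 (λ a b c d → :- X a b c d := X c d a b) refl a b c d

  cross-self : ∀ u → cross u u ≡ 0#
  cross-self (a , b) = solve 2 (λ a b → X a b a b := con (+ 0)) refl a b

  cross-O : ∀ u → cross u O ≡ 0#
  cross-O (a , b) = trans (cong₂ _-_ (zeroʳ a) (zeroʳ b)) (-‿inverseʳ 0#)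

  cross-Oˡ : ∀ u → cross O u ≡ 0#
  cross-Oˡ (a , b) = trans (cong₂ _-_ (zeroˡ b) (zeroˡ a)) (-‿inverseʳ 0#)

  -- Cramer's rule gives the linear dependence (r×v) q + (v×q) r + (q×r) v = 0 of three plane
  -- vectors; here it is crossed with `z`.
  cross-cyclic : ∀ q r v z →
    cross r v * cross q z + cross v q * cross r z + cross q r * cross v z ≡ 0#
  cross-cyclic (a , b) (c , d) (e , f) (g , h) =
    solve 8 (λ a b c d e f g h →
      X c d e f :* X a b g h :+ X e f a b :* X c d g h :+ X a b c d :* X e f g h := con (+ 0))
      refl a b c d e f g h

  cross-cyclic-parallel : ∀ q r v z → cross q r ≡ 0# →
    cross r v * cross q z + cross v q * cross r z ≡ 0#
  cross-cyclic-parallel q r v z qr≡0 = begin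
    a                          ≡⟨ +-identityʳ a ⟨
    a + 0#                     ≡⟨ cong (λ t → a + t) (zeroˡ (cross v z)) ⟨
    a + 0# * cross v z         ≡⟨ cong (λ t → a + t * cross v z) qr≡0 ⟨
    a + cross q r * cross v z  ≡⟨ cross-cyclic q r v z ⟩
    0#                         ∎
    where
    open ≡-Reasoning
    a : Carrier
    a = cross r v * cross q z + cross v q * cross r z

  nonneg-swap : ∀ u v → 0# ≤ - cross u v → 0# ≤ cross v u
  nonneg-swap u v = subst (0# ≤_) (cross-antisym u v)

  pos-swap : ∀ u v → 0# < - cross u v → 0# < cross v u
  pos-swap u v = subst (0# <_) (cross-antisym u v)

  cross-pos⇒≢O : ∀ u v → 0# < cross u v → ¬ u ≡ O
  cross-pos⇒≢O u v 0<uv refl = pos⇒≢0 0<uv (cross-Oˡ v)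

  origin-or-not : ∀ (u : Point) → u ≡ O ⊎ ¬ u ≡ O
  origin-or-not (a , b) with zero-nonzero a | zero-nonzero b
  ... | inj₁ refl | inj₁ refl = inj₁ refl
  ... | inj₂ a≢0  | _         = inj₂ λ { refl → a≢0 refl }
  ... | inj₁ _    | inj₂ b≢0  = inj₂ λ { refl → b≢0 refl }

  dot-self-pos : ∀ u → ¬ u ≡ O → 0# < dot u u
  dot-self-pos (a , b) u≢O with zero-nonzero a
  ... | inj₂ a≢0  = +-pos-nonneg (square-pos a≢0) (square-nonneg b)
  ... | inj₁ refl = +-nonneg-pos (square-nonneg 0#) (square-pos λ { refl → u≢O refl })

  -- Vectors around the origin

  -- In the basis `x`, `y` the vector `z` has coordinates `cross z y` and `cross x z`, each divided
  -- by `cross x y`.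
  InCone : Point → Point → Point → Set
  InCone x y z = 0# < cross x y × 0# ≤ cross x z × 0# ≤ cross z y

  PositivelySpans : FinSet → Set
  PositivelySpans L = ∀ z → Σ Point λ x → Σ Point λ y → x ∈ L × y ∈ L × InCone x y z

  -- Going round `q`, `r`, `v`, the cross product with `z` must pass from nonnegative to nonpositive
  -- somewhere, and `z` lies in the cone where it does; a constant sign would contradict
  -- `cross-cyclic`. Strict and weak tests are mixed so that each excluded case has a strictly
  -- positive summand.
  triangle-spans : ∀ {L q r v} → q ∈ L → r ∈ L → v ∈ L →
    0# < cross q r → 0# < cross r v → 0# < cross v q → PositivelySpans L
  triangle-spans {L} {q} {r} {v} q∈ r∈ v∈ qr rv vq z
    with nonneg-neg (cross q z) | pos-nonpos (cross r z) | nonneg-neg (cross r z) | pos-nonpos (cross v z) | nonneg-neg (cross v z)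
  ... | inj₁ qz | inj₂ rz | _ | _ | _ = q , r , q∈ , r∈ , qr , qz , nonneg-swap r z rz
  ... | inj₁ qz | inj₁ rz | _ | inj₂ vz | _ = r , v , r∈ , v∈ , rv , inj₁ rz , nonneg-swap v z vz
  ... | inj₁ qz | inj₁ rz | _ | inj₁ vz | _ = ⊥-elim (pos⇒≢0
          (+-pos (+-nonneg-pos (*-nonneg (inj₁ rv) qz) (*-pos vq rz)) (*-pos qr vz))
          (cross-cyclic q r v z))
  ... | inj₂ qz | _ | _ | _ | inj₁ vz = v , q , v∈ , q∈ , vq , vz , inj₁ (pos-swap q z qz)
  ... | inj₂ qz | _ | inj₁ rz | _ | inj₂ vz = r , v , r∈ , v∈ , rv , rz , inj₁ (pos-swap v z vz)
  ... | inj₂ qz | _ | inj₂ rz | _ | inj₂ vz = ⊥-elim (pos⇒≢0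
          (+-pos (+-pos (*-pos rv qz) (*-pos vq rz)) (*-pos qr vz))
          (trans (solve 6 (λ a b c d e f →
                    a :* (:- b) :+ c :* (:- d) :+ e :* (:- f) := :- (a :* b :+ c :* d :+ e :* f))
                    refl (cross r v) (cross q z) (cross v q) (cross r z) (cross q r) (cross v z))
          (trans (cong -_ (cross-cyclic q r v z)) -0#≈0#)))

  -- Here q and r point in opposite directions, with s and v on either side of their line.
  quadrilateral-spans : ∀ {L q s r v} → q ∈ L → s ∈ L → r ∈ L → v ∈ L → cross q r ≡ 0# →
    0# < cross q s → 0# < cross s r → 0# < cross r v → 0# < cross v q → PositivelySpans L
  quadrilateral-spans {L} {q} {s} {r} {v} q∈ s∈ r∈ v∈ qr≡0 qs sr rv vq z
    with nonneg-neg (cross q z) | pos-nonpos (cross s z) | pos-nonpos (cross r z) | nonneg-neg (cross r z) | nonneg-neg (cross v z)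
  ... | inj₁ qz | inj₂ sz | _ | _ | _ = q , s , q∈ , s∈ , qs , qz , nonneg-swap s z sz
  ... | inj₁ qz | inj₁ sz | inj₂ rz | _ | _ = s , r , s∈ , r∈ , sr , inj₁ sz , nonneg-swap r z rz
  ... | inj₁ qz | inj₁ sz | inj₁ rz | _ | _ = ⊥-elim (pos⇒≢0
          (+-nonneg-pos (*-nonneg (inj₁ rv) qz) (*-pos vq rz)) (cross-cyclic-parallel q r v z qr≡0))
  ... | inj₂ qz | _ | _ | _ | inj₁ vz = v , q , v∈ , q∈ , vq , vz , inj₁ (pos-swap q z qz)
  ... | inj₂ qz | _ | _ | inj₁ rz | inj₂ vz = r , v , r∈ , v∈ , rv , rz , inj₁ (pos-swap v z vz)
  ... | inj₂ qz | _ | _ | inj₂ rz | inj₂ vz = ⊥-elim (pos⇒≢0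
          (+-pos (*-pos rv qz) (*-pos vq rz))
          (trans (solve 4 (λ a b c d → a :* (:- b) :+ c :* (:- d) := :- (a :* b :+ c :* d))
                    refl (cross r v) (cross q z) (cross v q) (cross r z))
          (trans (cong -_ (cross-cyclic-parallel q r v z qr≡0)) -0#≈0#)))

  -- In `support`, the vector `q` is a clockwise-most one and belongs to `L`; for differences from a
  -- base point this yields a side whose other end is again a point of the set.
  data Winding (L : FinSet) : Set where
    all-zero : (∀ {r} → r ∈ L → r ≡ O) → Winding L
    support  : ∀ q → q ∈ L → ¬ q ≡ O → (∀ {r} → r ∈ L → 0# ≤ cross q r) → Winding L
    spanning : PositivelySpans L → Winding L

  -- The critical case is `v` strictly to the right of the old support `q`. Then `v` takes over
  -- unless some `r` lies strictly to the right of `v`; in that event `q`, `r`, `v` wind once around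
  -- the origin, except when `r` is opposite to `q`.
  winding-∷ : ∀ v {L} → Winding L → Winding (v ∷ L)
  winding-∷ v (all-zero zeros) with origin-or-not v
  ... | inj₁ v≡O = all-zero λ { (here refl) → v≡O ; (there r∈) → zeros r∈ }
  ... | inj₂ v≢O = support v (here refl) v≢O λ
          { (here refl) → inj₂ (sym (cross-self v))
          ; (there r∈)  → inj₂ (sym (trans (cong (cross v) (zeros r∈)) (cross-O v))) }
  winding-∷ v (spanning spans) = spanning λ z →
    let (x , y , x∈ , y∈ , cone) = spans z in x , y , there x∈ , there y∈ , cone
  winding-∷ v {L} (support q q∈ q≢O left) with nonneg-neg (cross q v)
  ... | inj₁ qv = support q (there q∈) q≢O λ { (here refl) → qv ; (there r∈) → left r∈ }
  ... | inj₂ -qv with All.decide (λ r → nonneg-neg (cross v r)) L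
  ...   | inj₁ v-left = support v (here refl) (cross-pos⇒≢O v q (pos-swap q v -qv)) λ
            { (here refl) → inj₂ (sym (cross-self v)) ; (there r∈) → All.lookup v-left r∈ }
  ...   | inj₂ some with find some
  ...     | r , r∈ , -vr with left r∈
  ...       | inj₁ qr = spanning (triangle-spans (there q∈) (there r∈) (here refl)
                qr (pos-swap v r -vr) (pos-swap q v -qv))
  ...       | inj₂ 0≡qr = decide-opposite
    where
    vq : 0# < cross v q
    vq = pos-swap q v -qv
    rv : 0# < cross r v
    rv = pos-swap v r -vr

    -- Both factors in front are positive, so `cross q s` and `cross s r` have the same sign: `r`
    -- points opposite to `q`.
    collinear-relation : ∀ s → cross r v * cross q s ≡ cross v q * cross s r
    collinear-relation s = begin
      a                              ≡⟨ solve 3 (λ a b c → a := (a :+ b :* c) :+ b :* (:- c)) refl a b c ⟩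
      (a + b * c) + b * - c          ≡⟨ cong₂ _+_ (cross-cyclic-parallel q r v s (sym 0≡qr)) (cong (b *_) (cross-antisym r s)) ⟩
      0# + b * cross s r             ≡⟨ +-identityˡ _ ⟩
      b * cross s r                  ∎
      where
      open ≡-Reasoning
      a b c : Carrier
      a = cross r v * cross q s
      b = cross v q
      c = cross r s

    decide-opposite : Winding (v ∷ L)
    decide-opposite with All.decide (λ s → zero-nonzero (cross q s)) L
    -- All of `L` lies on the line through `q` and `r`, and `v` is strictly to the left of `r`, so
    -- `r` is the new clockwise-most vector.
    ... | inj₁ flat = support r (there r∈) (cross-pos⇒≢O r v rv) λ
            { (here refl) → inj₁ rv
            ; (there s∈) → inj₂ (rs≡0 (All.lookup flat s∈)) }
      where
      rs≡0 : ∀ {s} → cross q s ≡ 0# → 0# ≡ cross r s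
      rs≡0 {s} qs≡0 = trans (sym (trans (cong -_ sr≡0) -0#≈0#)) (cross-antisym s r)
        where
        sr≡0 : cross s r ≡ 0#
        sr≡0 = *-cancelˡ-zero (pos⇒≢0 vq)
          (trans (sym (collinear-relation s)) (trans (cong (cross r v *_) qs≡0) (zeroʳ _)))
    ... | inj₂ some′ with find some′
    ...   | s , s∈ , qs≢0 with left s∈
    ...     | inj₂ 0≡qs = ⊥-elim (qs≢0 (sym 0≡qs))
    ...     | inj₁ qs = spanning (quadrilateral-spans (there q∈) (there s∈) (there r∈) (here refl)
                (sym 0≡qr) qs (*-cancelˡ-pos vq (subst (0# <_) (collinear-relation s) (*-pos rv qs))) rv vq)

  winding : ∀ L → Winding L
  winding []      = all-zero λ ()
  winding (v ∷ L) = winding-∷ v (winding L)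

  -- Neighbourhoods and interior points

  Near : (Point → Set) → Set
  Near P = Σ Carrier λ ε → 0# < ε ×
    (∀ x y → - ε < x → x < ε → - ε < y → y < ε → P (x , y))

  near-always : ∀ {P : Point → Set} → (∀ z → P z) → Near P
  near-always P-holds = 1# , 0<1 , λ x y _ _ _ _ → P-holds (x , y)

  near-× : ∀ {P Q : Point → Set} → Near P → Near Q → Near (λ z → P z × Q z)
  near-× {P} {Q} (ε , 0<ε , p) (δ , 0<δ , q) with <-tri ε δ
  ... | tri≈ _ refl _ = ε , 0<ε , λ x y a b c d → p x y a b c d , q x y a b c d
  ... | tri< ε<δ _ _ = ε , 0<ε , λ x y a b c d → p x y a b c d ,
          q x y (<-trans -δ<-ε a) (<-trans b ε<δ) (<-trans -δ<-ε c) (<-trans d ε<δ)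
    where
    -δ<-ε : - δ < - ε
    -δ<-ε = 0<-⇒< (subst (0# <_) (solve 2 (λ δ ε → δ :- ε := (:- ε) :- (:- δ)) refl δ ε) (<⇒0<- ε<δ))
  ... | tri> _ _ δ<ε = δ , 0<δ , λ x y a b c d →
          p x y (<-trans -ε<-δ a) (<-trans b δ<ε) (<-trans -ε<-δ c) (<-trans d δ<ε) , q x y a b c d
    where
    -ε<-δ : - ε < - δ
    -ε<-δ = 0<-⇒< (subst (0# <_) (solve 2 (λ δ ε → ε :- δ := (:- δ) :- (:- ε)) refl δ ε) (<⇒0<- δ<ε))

  near-All : ∀ {P : Point → Point → Set} → (∀ x → Near (P x)) → ∀ xs → Near (λ z → All (λ x → P x z) xs)
  near-All near []       = near-always λ _ → []
  near-All near (x ∷ xs) = let (ε , 0<ε , h) = near-× (near x) (near-All near xs) in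
    ε , 0<ε , λ x y a b c d → let (p , ps) = h x y a b c d in p ∷ ps

  abs-bound-* : ∀ {ε t M c} → - ε < t → t < ε → 0# ≤ M - c → 0# ≤ M + c → 0# ≤ ε * M - t * c
  abs-bound-* {ε} {t} {M} {c} -ε<t t<ε M-c M+c = *-cancelˡ-nonneg 0<2
    (subst (0# ≤_)
      (trans (solve 4 (λ ε t M c → (ε :- t) :* (M :+ c) :+ (t :- (:- ε)) :* (M :- c)
                            := (ε :* M :- t :* c) :+ (ε :* M :- t :* c)) refl ε t M c)
             (double (ε * M - t * c)))
      (+-nonneg (*-nonneg (inj₁ (<⇒0<- t<ε)) M+c) (*-nonneg (inj₁ (<⇒0<- -ε<t)) M-c)))

  near-linear : ∀ c c′ d → 0# < d → Near (λ z → 0# ≤ d - (proj₁ z * c + proj₂ z * c′))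
  near-linear c c′ d 0<d =
    let (M  , 0≤M  , M-c   , M+c)   = ∃-abs-bound c
        (M′ , 0≤M′ , M′-c′ , M′+c′) = ∃-abs-bound c′
        (ε , 0<ε , d≡)              = split-pos 0<d (+-nonneg 0≤M 0≤M′)
    in ε , 0<ε , λ x y l₁ r₁ l₂ r₂ → inj₁ (subst (0# <_)
         (trans (solve 5 (λ ε M M′ s t → ε :+ ((ε :* M :- s) :+ (ε :* M′ :- t))
                   := (ε :+ ε :* (M :+ M′)) :- (s :+ t)) refl ε M M′ (x * c) (y * c′))
           (cong (λ e → e - (x * c + y * c′)) (sym d≡)))
         (+-pos-nonneg 0<ε (+-nonneg (abs-bound-* l₁ r₁ M-c M+c) (abs-bound-* l₂ r₂ M′-c′ M′+c′))))

  -- For z = αx + βy the bound says α + β ≤ 1, so that `z` does not pass beyond the line through `x`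
  -- and `y`. Positivity of `cross x y` is a premise inside the neighbourhood, which makes the claim
  -- meaningful for every pair of vectors.
  near-cone : ∀ x y → Near (λ z → 0# < cross x y → 0# ≤ cross x y - (cross z y + cross x z))
  near-cone x@(x₁ , x₂) y@(y₁ , y₂) with pos-nonpos (cross x y)
  ... | inj₂ 0≤-xy = near-always λ _ 0<xy → ⊥-elim (nonneg-neg-⊥ 0≤-xy
          (subst (0# <_) (sym (neg-involutive _)) 0<xy))
  ... | inj₁ 0<xy = let (ε , 0<ε , h) = near-linear (y₂ - x₂) (x₁ - y₁) (cross x y) 0<xy in
          ε , 0<ε , λ s t a b c d _ → subst (λ e → 0# ≤ cross x y - e)
            (solve 6 (λ x₁ x₂ y₁ y₂ s t → s :* (y₂ :- x₂) :+ t :* (x₁ :- y₁) := X s t y₁ y₂ :+ X x₁ x₂ s t)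
              refl x₁ x₂ y₁ y₂ s t)
            (h s t a b c d)

  -- Cramer's rule writes `p′ ⊝ p` in terms of `a ⊝ p` and `b ⊝ p`; the last hypothesis leaves a
  -- nonnegative weight γ for `p` itself.
  cone-hull : ∀ {C : Point → Set} {p a b p′} → C p → C a → C b →
    InCone (a ⊝ p) (b ⊝ p) (p′ ⊝ p) →
    0# ≤ cross (a ⊝ p) (b ⊝ p) - (cross (p′ ⊝ p) (b ⊝ p) + cross (a ⊝ p) (p′ ⊝ p)) →
    InHull C p′
  cone-hull {C} {p} {a} {b} {p′} Cp Ca Cb (xy , xz , zy) small with inverse-pos xy
  ... | k , Dk≡1 , 0<k =
    3 , point , weight , point∈ , weight≥0 , total ,
    coordinate (proj₁ a) (proj₁ b) (proj₁ p) (proj₁ p′)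
      (solve 6 (λ x₁ x₂ y₁ y₂ z₁ z₂ → X z₁ z₂ y₁ y₂ :* x₁ :+ X x₁ x₂ z₁ z₂ :* y₁ := X x₁ x₂ y₁ y₂ :* z₁)
        refl (proj₁ x) (proj₂ x) (proj₁ y) (proj₂ y) (proj₁ z) (proj₂ z)) ,
    coordinate (proj₂ a) (proj₂ b) (proj₂ p) (proj₂ p′)
      (solve 6 (λ x₁ x₂ y₁ y₂ z₁ z₂ → X z₁ z₂ y₁ y₂ :* x₂ :+ X x₁ x₂ z₁ z₂ :* y₂ := X x₁ x₂ y₁ y₂ :* z₂)
        refl (proj₁ x) (proj₂ x) (proj₁ y) (proj₂ y) (proj₁ z) (proj₂ z))
    where
    x y z : Point
    x = a ⊝ p
    y = b ⊝ p
    z = p′ ⊝ p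
    D α β γ : Carrier
    D = cross x y
    α = cross z y * k
    β = cross x z * k
    γ = 1# - (α + β)
    point : Fin 3 → Point
    point zero             = a
    point (suc zero)       = b
    point (suc (suc zero)) = p
    weight : Fin 3 → Carrier
    weight zero             = α
    weight (suc zero)       = β
    weight (suc (suc zero)) = γ
    point∈ : ∀ i → C (point i)
    point∈ zero             = Ca
    point∈ (suc zero)       = Cb
    point∈ (suc (suc zero)) = Cp
    weight≥0 : ∀ i → 0# ≤ weight i
    weight≥0 zero             = *-nonneg zy (inj₁ 0<k)
    weight≥0 (suc zero)       = *-nonneg xz (inj₁ 0<k)
    weight≥0 (suc (suc zero)) = subst (λ t → 0# ≤ t - (α + β)) Dk≡1
      (subst (0# ≤_) (solve 4 (λ D s t k → (D :- (s :+ t)) :* k := D :* k :- (s :* k :+ t :* k))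
          refl D (cross z y) (cross x z) k)
        (*-nonneg small (inj₁ 0<k)))
    total : α + (β + (γ + 0#)) ≡ 1#
    total = trans (cong (λ t → α + (β + t)) (+-identityʳ γ))
      (solve 3 (λ α β one → α :+ (β :+ (one :- (α :+ β))) := one) refl α β 1#)
    coordinate : ∀ a₁ b₁ p₁ p₁′ →
      cross z y * (a₁ - p₁) + cross x z * (b₁ - p₁) ≡ D * (p₁′ - p₁) →
      α * a₁ + (β * b₁ + (γ * p₁ + 0#)) ≡ p₁′
    coordinate a₁ b₁ p₁ p₁′ eq = begin
      α * a₁ + (β * b₁ + (γ * p₁ + 0#))
        ≡⟨ cong (λ t → α * a₁ + (β * b₁ + t)) (+-identityʳ _) ⟩
      α * a₁ + (β * b₁ + γ * p₁)
        ≡⟨ solve 7 (λ s t k a b p one → s :* k :* a :+ (t :* k :* b :+ (one :- (s :* k :+ t :* k)) :* p)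
              := one :* p :+ (s :* (a :- p) :+ t :* (b :- p)) :* k)
            refl (cross z y) (cross x z) k a₁ b₁ p₁ 1# ⟩
      1# * p₁ + (cross z y * (a₁ - p₁) + cross x z * (b₁ - p₁)) * k
        ≡⟨ cong₂ (λ s t → s + t * k) (*-identityˡ p₁) eq ⟩
      p₁ + D * (p₁′ - p₁) * k
        ≡⟨ solve 4 (λ D q p k → p :+ D :* (q :- p) :* k := p :+ (D :* k) :* (q :- p)) refl D p₁′ p₁ k ⟩
      p₁ + D * k * (p₁′ - p₁)
        ≡⟨ cong (λ t → p₁ + t * (p₁′ - p₁)) Dk≡1 ⟩
      p₁ + 1# * (p₁′ - p₁)
        ≡⟨ cong (λ t → p₁ + t) (*-identityˡ _) ⟩
      p₁ + (p₁′ - p₁)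
        ≡⟨ solve 2 (λ p q → p :+ (q :- p) := q) refl p₁ p₁′ ⟩
      p₁′ ∎
      where open ≡-Reasoning

  -- The cone that contains `p′ ⊝ p` varies with `p′` while the radius may not, so smallness is
  -- required for all of the finitely many pairs at once.
  spanning⇒interior : ∀ {A p} → p ∈ A → PositivelySpans (map (_⊝ p) A) → InInterior (_∈ A) p
  spanning⇒interior {A} {p} p∈A spans =
    let (ε , 0<ε , near) = near-All (λ x → near-All (near-cone x) L) L
    in ε , 0<ε , λ x′ y′ l₁ u₁ l₂ u₂ → hull (x′ , y′) (near _ _ l₁ u₁ l₂ u₂)
    where
    L : FinSet
    L = map (_⊝ p) A
    hull : ∀ p′ → All (λ x → All (λ y → 0# < cross x y →
        0# ≤ cross x y - (cross (p′ ⊝ p) y + cross x (p′ ⊝ p))) L) L → InHull (_∈ A) p′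
    hull p′ small with spans (p′ ⊝ p)
    ... | x , y , x∈ , y∈ , cone with ∈-map⁻ (_⊝ p) x∈ | ∈-map⁻ (_⊝ p) y∈
    ...   | a , a∈ , refl | b , b∈ , refl =
            cone-hull p∈A a∈ b∈ cone (All.lookup (All.lookup small x∈) y∈ (proj₁ cone))

  -- Edges and boundary points

  -- A directed piece of a side, with the set on its left. The point `a` may be any point of the
  -- side but its counterclockwise end, and `a ⊕ u` any later point of the set on it; only the
  -- direction of `u` is canonical.
  record Edge (C : Point → Set) (a u : Point) : Set where
    field
      nonzero : ¬ u ≡ O
      start   : C a
      end     : C (a ⊕ u)
      left    : ∀ {r} → C r → 0# ≤ cross u (r ⊝ a)

  open Edge

  ⊕-⊝ : ∀ p q → p ⊕ (q ⊝ p) ≡ q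
  ⊕-⊝ (a , b) (c , d) = cong₂ _,_ (eq a c) (eq b d)
    where
    eq : ∀ a c → a + (c - a) ≡ c
    eq = solve 2 (λ a c → a :+ (c :- a) := c) refl

  boundary-edge : ∀ {A a} → ¬ Collinear (_∈ A) → a ∈ A → ¬ InInterior (_∈ A) a → ∃ (Edge (_∈ A) a)
  boundary-edge {A} {a} non-collinear a∈A ¬interior with winding (map (_⊝ a) A)
  ... | spanning spans = ⊥-elim (¬interior (spanning⇒interior a∈A spans))
  ... | all-zero zeros = ⊥-elim (non-collinear
          -- Every point equals `a`, so the vertical line through `a` contains the set.
          (1# , 0# , 1# * proj₁ a + 0# * proj₂ a , (λ { (1≡0 , _) → 0≢1 (sym 1≡0) }) ,
           λ x y r∈ → cong (λ r → 1# * proj₁ r + 0# * proj₂ r) (same (x , y) (zeros (∈-map⁺ (_⊝ a) r∈)))))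
    where
    same : ∀ r → r ⊝ a ≡ O → r ≡ a
    same r r-a≡O = trans (sym (⊕-⊝ a r)) (trans (cong (a ⊕_) r-a≡O)
      (cong₂ _,_ (+-identityʳ _) (+-identityʳ _)))
  ... | support u u∈ u≢O left with ∈-map⁻ (_⊝ a) u∈
  ...   | q , q∈ , refl = u , record
          { nonzero = u≢O
          ; start   = a∈A
          ; end     = subst (_∈ A) (sym (⊕-⊝ a q)) q∈
          ; left    = λ r∈ → left (∈-map⁺ (_⊝ a) r∈) }

  cross-⊝ : ∀ u a b → cross u (b ⊝ a) ≡ cross u b - cross u a
  cross-⊝ (u₁ , u₂) (a₁ , a₂) (b₁ , b₂) =
    solve 6 (λ u₁ u₂ a₁ a₂ b₁ b₂ → X u₁ u₂ (b₁ :- a₁) (b₂ :- a₂) := X u₁ u₂ b₁ b₂ :- X u₁ u₂ a₁ a₂)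
      refl u₁ u₂ a₁ a₂ b₁ b₂

  dot-⊝ : ∀ u a b → dot u (b ⊝ a) ≡ dot u b - dot u a
  dot-⊝ (u₁ , u₂) (a₁ , a₂) (b₁ , b₂) =
    solve 6 (λ u₁ u₂ a₁ a₂ b₁ b₂ → u₁ :* (b₁ :- a₁) :+ u₂ :* (b₂ :- a₂)
        := (u₁ :* b₁ :+ u₂ :* b₂) :- (u₁ :* a₁ :+ u₂ :* a₂))
      refl u₁ u₂ a₁ a₂ b₁ b₂

  ΣF-nonneg : ∀ {n} (f : Fin n → Carrier) → (∀ i → 0# ≤ f i) → 0# ≤ ΣF f
  ΣF-nonneg {zero}  f f≥0 = inj₂ refl
  ΣF-nonneg {suc n} f f≥0 = +-nonneg (f≥0 zero) (ΣF-nonneg (λ i → f (suc i)) (λ i → f≥0 (suc i)))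

  ΣF-translate : ∀ {n} (w f : Fin n → Carrier) t →
    ΣF (λ i → w i * (t + f i)) ≡ ΣF w * t + ΣF (λ i → w i * f i)
  ΣF-translate {zero}  w f t = solve 1 (λ t → con (+ 0) := con (+ 0) :* t :+ con (+ 0)) refl t
  ΣF-translate {suc n} w f t =
    trans (cong (λ s → w zero * (t + f zero) + s) (ΣF-translate (λ i → w (suc i)) (λ i → f (suc i)) t))
      (solve 5 (λ w f t W S → w :* (t :+ f) :+ (W :* t :+ S) := (w :+ W) :* t :+ (w :* f :+ S))
        refl (w zero) (f zero) t (ΣF (λ i → w (suc i))) (ΣF (λ i → w (suc i) * f (suc i))))

  ΣF-cross : ∀ {n} (u : Point) (w : Fin n → Carrier) (q : Fin n → Point) →
    ΣF (λ i → w i * cross u (q i)) ≡ cross u (ΣF (λ i → w i * proj₁ (q i)) , ΣF (λ i → w i * proj₂ (q i)))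
  ΣF-cross {zero}  u w q = sym (cross-O u)
  ΣF-cross {suc n} (u₁ , u₂) w q =
    trans (cong (λ t → w zero * cross (u₁ , u₂) (q zero) + t) (ΣF-cross (u₁ , u₂) (λ i → w (suc i)) (λ i → q (suc i))))
      (solve 7 (λ u₁ u₂ w x y Sx Sy →
          w :* X u₁ u₂ x y :+ X u₁ u₂ Sx Sy := X u₁ u₂ (w :* x :+ Sx) (w :* y :+ Sy))
        refl u₁ u₂ (w zero) (proj₁ (q zero)) (proj₂ (q zero))
        (ΣF (λ i → w (suc i) * proj₁ (q (suc i)))) (ΣF (λ i → w (suc i) * proj₂ (q (suc i)))))

  hull-halfplane : ∀ {C : Point → Set} {u p p′} → (∀ {r} → C r → 0# ≤ cross u (r ⊝ p)) →
    InHull C p′ → 0# ≤ cross u (p′ ⊝ p)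
  hull-halfplane {u = u} {p} {p′} left (n , q , w , Cq , w≥0 , Σw≡1 , Σx , Σy) =
    subst (0# ≤_) (begin
        ΣF (λ i → w i * (- cross u p + cross u (q i)))
          ≡⟨ ΣF-translate w (λ i → cross u (q i)) (- cross u p) ⟩
        ΣF w * - cross u p + ΣF (λ i → w i * cross u (q i))
          ≡⟨ cong₂ _+_ (trans (cong (_* - cross u p) Σw≡1) (*-identityˡ _))
               (trans (ΣF-cross u w q) (cong₂ (λ s t → cross u (s , t)) Σx Σy)) ⟩
        - cross u p + cross u p′
          ≡⟨ +-comm _ _ ⟩
        cross u p′ - cross u p
          ≡⟨ cross-⊝ u p p′ ⟨
        cross u (p′ ⊝ p) ∎)
      (ΣF-nonneg (λ i → w i * (- cross u p + cross u (q i))) (λ i → *-nonneg (w≥0 i)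
        (subst (0# ≤_) (trans (cross-⊝ u p (q i)) (+-comm _ _)) (left (Cq i)))))
    where open ≡-Reasoning

  near-ray : ∀ {ε} → 0# < ε → ∀ c c′ → Σ Carrier λ δ → 0# < δ ×
    (- ε < δ * c × δ * c < ε) × (- ε < δ * c′ × δ * c′ < ε)
  near-ray {ε} 0<ε c c′ =
    let (M  , 0≤M  , M-c   , M+c)   = ∃-abs-bound c
        (M′ , 0≤M′ , M′-c′ , M′+c′) = ∃-abs-bound c′
        (δ , 0<δ , ε≡)              = split-pos 0<ε (+-nonneg 0≤M 0≤M′)
    in δ , 0<δ , bound 0<δ M-c M+c 0≤M′ ε≡ ,
       bound 0<δ M′-c′ M′+c′ 0≤M (trans ε≡ (cong (λ t → δ + δ * t) (+-comm M M′)))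
    where
    bound : ∀ {δ c M M′} → 0# < δ → 0# ≤ M - c → 0# ≤ M + c → 0# ≤ M′ → ε ≡ δ + δ * (M + M′) →
      - ε < δ * c × δ * c < ε
    bound {δ} {c} {M} {M′} 0<δ M-c M+c 0≤M′ eq =
      subst (λ e → - e < δ * c × δ * c < e) (sym eq)
        ( 0<-⇒< (subst (0# <_) (solve 4 (λ δ c M M′ → δ :+ (δ :* (M :+ c) :+ δ :* M′)
                    := δ :* c :- (:- (δ :+ δ :* (M :+ M′)))) refl δ c M M′)
            (+-pos-nonneg 0<δ (+-nonneg (*-nonneg (inj₁ 0<δ) M+c) (*-nonneg (inj₁ 0<δ) 0≤M′))))
        , 0<-⇒< (subst (0# <_) (solve 4 (λ δ c M M′ → δ :+ (δ :* (M :- c) :+ δ :* M′)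
                    := (δ :+ δ :* (M :+ M′)) :- δ :* c) refl δ c M M′)
            (+-pos-nonneg 0<δ (+-nonneg (*-nonneg (inj₁ 0<δ) M-c) (*-nonneg (inj₁ 0<δ) 0≤M′)))))

  cross-outward : ∀ δ u → δ * dot u u ≡ - cross u (δ * proj₂ u , δ * - proj₁ u)
  cross-outward δ (u₁ , u₂) = solve 3 (λ δ u₁ u₂ →
    δ :* (u₁ :* u₁ :+ u₂ :* u₂) := :- X u₁ u₂ (δ :* u₂) (δ :* (:- u₁))) refl δ u₁ u₂

  +-cancel-left : ∀ a b → a + b - a ≡ b
  +-cancel-left = solve 2 (λ a b → a :+ b :- a := b) refl

  ⊕-cancel-left : ∀ p w → (p ⊕ w) ⊝ p ≡ w
  ⊕-cancel-left p w = cong₂ _,_ (+-cancel-left (proj₁ p) (proj₁ w)) (+-cancel-left (proj₂ p) (proj₂ w))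

  -- A short step along the outward normal (u₂, -u₁) leaves the half-plane that contains the hull.
  edge⇒¬interior : ∀ {C : Point → Set} {p u} → Edge C p u → ¬ InInterior C p
  edge⇒¬interior {C} {p} {u} e (ε , 0<ε , inside) = nonneg-neg-⊥ w-left w-right
    where
    ray : Σ Carrier λ δ → 0# < δ ×
      (- ε < δ * proj₂ u × δ * proj₂ u < ε) × (- ε < δ * - proj₁ u × δ * - proj₁ u < ε)
    ray = near-ray 0<ε (proj₂ u) (- proj₁ u)
    δ : Carrier
    δ = proj₁ ray
    w : Point
    w = δ * proj₂ u , δ * - proj₁ u
    w-hull : InHull C (p ⊕ w)
    w-hull = let (_ , _ , (l₁ , r₁) , (l₂ , r₂)) = ray in
      inside (proj₁ (p ⊕ w)) (proj₂ (p ⊕ w))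
        (subst (λ t → - ε < t) (sym (+-cancel-left (proj₁ p) (proj₁ w))) l₁)
        (subst (λ t → t < ε) (sym (+-cancel-left (proj₁ p) (proj₁ w))) r₁)
        (subst (λ t → - ε < t) (sym (+-cancel-left (proj₂ p) (proj₂ w))) l₂)
        (subst (λ t → t < ε) (sym (+-cancel-left (proj₂ p) (proj₂ w))) r₂)
    w-left : 0# ≤ cross u w
    w-left = subst (λ z → 0# ≤ cross u z) (⊕-cancel-left p w)
      (hull-halfplane {C} {u} {p} {p ⊕ w} (left e) w-hull)
    w-right : 0# < - cross u w
    w-right = subst (λ t → 0# < t) (cross-outward δ u)
      (*-pos (proj₁ (proj₂ ray)) (dot-self-pos u (nonzero e)))

  -- Translates of hulls and interiors

  hull-translate : ∀ {C D : Point → Set} t → (∀ {q} → C q → D (t ⊕ q)) →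
    ∀ {p} → InHull C p → InHull D (t ⊕ p)
  hull-translate (t₁ , t₂) C⇒D (n , q , w , Cq , w≥0 , Σw≡1 , Σx , Σy) =
    n , (λ i → (t₁ , t₂) ⊕ q i) , w , (λ i → C⇒D (Cq i)) , w≥0 , Σw≡1 ,
    coordinate t₁ (λ i → proj₁ (q i)) Σx , coordinate t₂ (λ i → proj₂ (q i)) Σy
    where
    coordinate : ∀ t (f : Fin n → Carrier) {s} → ΣF (λ i → w i * f i) ≡ s →
      ΣF (λ i → w i * (t + f i)) ≡ t + s
    coordinate t f Σf = trans (ΣF-translate w f t)
      (cong₂ _+_ (trans (cong (_* t) Σw≡1) (*-identityˡ t)) Σf)

  interior-translate : ∀ {C D : Point → Set} t → (∀ {q} → C q → D (t ⊕ q)) →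
    ∀ {p} → InInterior C p → InInterior D (t ⊕ p)
  interior-translate {C} {D} (t₁ , t₂) C⇒D {p₁ , p₂} (ε , 0<ε , inside) =
    ε , 0<ε , λ x y l₁ r₁ l₂ r₂ → subst (InHull D) (⊕-⊝ (t₁ , t₂) (x , y))
      (hull-translate {C} {D} (t₁ , t₂) C⇒D (inside (x - t₁) (y - t₂)
        (subst (- ε <_) (shift x t₁ p₁) l₁) (subst (_< ε) (shift x t₁ p₁) r₁)
        (subst (- ε <_) (shift y t₂ p₂) l₂) (subst (_< ε) (shift y t₂ p₂) r₂)))
    where
    shift : ∀ x t p → x - (t + p) ≡ x - t - p
    shift = solve 3 (λ x t p → x :- (t :+ p) := x :- t :- p) refl

  -- Uniqueness of the edge direction

  infixr 7 _∙_

  _∙_ : Carrier → Point → Point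
  k ∙ u = k * proj₁ u , k * proj₂ u

  -- First coordinate of |u|² v = (u·v) u + (u×v) u′, where u′ = (-u₂, u₁).
  dot-cross-expansion₁ : ∀ u v → dot u u * proj₁ v ≡ dot u v * proj₁ u - cross u v * proj₂ u
  dot-cross-expansion₁ (a , b) (c , d) = solve 4 (λ a b c d →
    (a :* a :+ b :* b) :* c := (a :* c :+ b :* d) :* a :- X a b c d :* b) refl a b c d

  dot-cross-expansion₂ : ∀ u v → dot u u * proj₂ v ≡ dot u v * proj₂ u + cross u v * proj₁ u
  dot-cross-expansion₂ (a , b) (c , d) = solve 4 (λ a b c d →
    (a :* a :+ b :* b) :* d := (a :* c :+ b :* d) :* b :+ X a b c d :* a) refl a b c d

  cross-zero⇒multiple : ∀ u v → ¬ u ≡ O → cross u v ≡ 0# →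
    Σ Carrier λ k → v ≡ (dot u v * k) ∙ u
  cross-zero⇒multiple u v u≢O uv≡0 = k , cong₂ _,_
      (coordinate (proj₁ v) (proj₁ u) (trans (dot-cross-expansion₁ u v)
        (trans (cong (λ t → dot u v * proj₁ u - t * proj₂ u) uv≡0)
          (solve 2 (λ a b → a :- con (+ 0) :* b := a) refl (dot u v * proj₁ u) (proj₂ u)))))
      (coordinate (proj₂ v) (proj₂ u) (trans (dot-cross-expansion₂ u v)
        (trans (cong (λ t → dot u v * proj₂ u + t * proj₁ u) uv≡0)
          (solve 2 (λ a b → a :+ con (+ 0) :* b := a) refl (dot u v * proj₂ u) (proj₁ u)))))
    where
    k : Carrier
    k = proj₁ (inverse (dot u u) (pos⇒≢0 (dot-self-pos u u≢O)))
    uuk≡1 : dot u u * k ≡ 1#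
    uuk≡1 = proj₂ (inverse (dot u u) (pos⇒≢0 (dot-self-pos u u≢O)))
    coordinate : ∀ v₁ u₁ → dot u u * v₁ ≡ dot u v * u₁ → v₁ ≡ dot u v * k * u₁
    coordinate v₁ u₁ eq = begin
      v₁                  ≡⟨ *-identityˡ v₁ ⟨
      1# * v₁             ≡⟨ cong (_* v₁) uuk≡1 ⟨
      dot u u * k * v₁    ≡⟨ solve 3 (λ a k v → a :* k :* v := a :* v :* k) refl (dot u u) k v₁ ⟩
      dot u u * v₁ * k    ≡⟨ cong (_* k) eq ⟩
      dot u v * u₁ * k    ≡⟨ solve 3 (λ a k v → a :* v :* k := a :* k :* v) refl (dot u v) k u₁ ⟩
      dot u v * k * u₁    ∎
      where open ≡-Reasoning

  zero-∙ : ∀ u → 0# ∙ u ≡ O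
  zero-∙ u = cong₂ _,_ (zeroˡ _) (zeroˡ _)

  cross-∙ : ∀ k u z → cross (k ∙ u) z ≡ k * cross u z
  cross-∙ k (a , b) (c , d) =
    solve 5 (λ k a b c d → X (k :* a) (k :* b) c d := k :* X a b c d) refl k a b c d

  -- A negative factor would put the set on both sides of the line through `p` along `u`, hence on
  -- that line.
  multiple-edge-positive : ∀ {C : Point → Set} {p u} k → ¬ Collinear C → Edge C p u → Edge C p (k ∙ u) → 0# < k
  multiple-edge-positive {C} {p} {u} k non-collinear e f with pos-zero-neg k
  ... | inj₁ 0<k = 0<k
  ... | inj₂ (inj₁ k≡0) = ⊥-elim (nonzero f (trans (cong (_∙ u) k≡0) (zero-∙ u)))
  ... | inj₂ (inj₂ 0<-k) = ⊥-elim (non-collinear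
          (- proj₂ u , proj₁ u , cross u p , non-zero , λ x y Cr → on-line (x , y) (flat Cr)))
    where
    non-zero : ¬ (- proj₂ u ≡ 0# × proj₁ u ≡ 0#)
    non-zero (-u₂≡0 , u₁≡0) = nonzero e (cong₂ _,_ u₁≡0
      (trans (sym (neg-involutive _)) (trans (cong -_ -u₂≡0) -0#≈0#)))
    flat : ∀ {r} → C r → cross u (r ⊝ p) ≡ 0#
    flat {r} Cr = nonneg-antisym (left e Cr) (*-cancelˡ-nonneg 0<-k
      (subst (0# ≤_) (trans (cross-∙ k u (r ⊝ p))
          (solve 2 (λ k c → k :* c := (:- k) :* (:- c)) refl k (cross u (r ⊝ p))))
        (left f Cr)))
    on-line : ∀ r → cross u (r ⊝ p) ≡ 0# → - proj₂ u * proj₁ r + proj₁ u * proj₂ r ≡ cross u p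
    on-line (x , y) eq = trans
      (solve 6 (λ u₁ u₂ p₁ p₂ x y → (:- u₂) :* x :+ u₁ :* y := X u₁ u₂ (x :- p₁) (y :- p₂) :+ X u₁ u₂ p₁ p₂)
        refl (proj₁ u) (proj₂ u) (proj₁ p) (proj₂ p) x y)
      (trans (cong (_+ cross u p) eq) (+-identityˡ _))

  -- The end of each edge lies weakly to the left of the other, which forces `cross u v` to vanish.
  edge-direction-unique : ∀ {C : Point → Set} {p u v} → ¬ Collinear C → Edge C p u → Edge C p v →
    Σ Carrier λ k → 0# < k × v ≡ k ∙ u
  edge-direction-unique {C} {p} {u} {v} non-collinear e f =
    let (k′ , v≡ku) = cross-zero⇒multiple u v (nonzero e) uv≡0 in
    dot u v * k′ , multiple-edge-positive (dot u v * k′) non-collinear e (subst (Edge C p) v≡ku f) , v≡ku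
    where
    uv≡0 : cross u v ≡ 0#
    uv≡0 = nonneg-antisym (subst (λ z → 0# ≤ cross u z) (⊕-cancel-left p v) (left e (end f)))
      (subst (0# ≤_) (sym (cross-antisym u v)) (subst (λ z → 0# ≤ cross v z) (⊕-cancel-left p u) (left f (end e))))

  -- First and last points of a face

  -- A minimum for this order is the first (τ = 1) or last (τ = −1) point on the face of direction u.
  LexNonneg : Carrier → Point → Point → Set
  LexNonneg τ u z = 0# ≤ cross u z × (cross u z ≡ 0# → 0# ≤ τ * dot u z)

  Extreme : Carrier → Point → FinSet → Point → Set
  Extreme τ u B b = b ∈ B × (∀ {r} → r ∈ B → LexNonneg τ u (r ⊝ b))

  cross-chain : ∀ u a b c → cross u (b ⊝ a) + cross u (c ⊝ b) ≡ cross u (c ⊝ a)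
  cross-chain u a b c = begin
    cross u (b ⊝ a) + cross u (c ⊝ b)
      ≡⟨ cong₂ _+_ (cross-⊝ u a b) (cross-⊝ u b c) ⟩
    (cross u b - cross u a) + (cross u c - cross u b)
      ≡⟨ solve 3 (λ a b c → (b :- a) :+ (c :- b) := c :- a) refl (cross u a) (cross u b) (cross u c) ⟩
    cross u c - cross u a
      ≡⟨ cross-⊝ u a c ⟨
    cross u (c ⊝ a) ∎
    where open ≡-Reasoning

  dot-chain : ∀ τ u a b c → τ * dot u (b ⊝ a) + τ * dot u (c ⊝ b) ≡ τ * dot u (c ⊝ a)
  dot-chain τ u a b c = begin
    τ * dot u (b ⊝ a) + τ * dot u (c ⊝ b)
      ≡⟨ cong₂ (λ s t → τ * s + τ * t) (dot-⊝ u a b) (dot-⊝ u b c) ⟩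
    τ * (dot u b - dot u a) + τ * (dot u c - dot u b)
      ≡⟨ solve 4 (λ τ a b c → τ :* (b :- a) :+ τ :* (c :- b) := τ :* (c :- a))
           refl τ (dot u a) (dot u b) (dot u c) ⟩
    τ * (dot u c - dot u a)
      ≡⟨ cong (τ *_) (dot-⊝ u a c) ⟨
    τ * dot u (c ⊝ a) ∎
    where open ≡-Reasoning

  cross-flip : ∀ u a b → - cross u (b ⊝ a) ≡ cross u (a ⊝ b)
  cross-flip u a b = trans (cong -_ (cross-⊝ u a b))
    (trans (solve 2 (λ a b → :- (b :- a) := a :- b) refl (cross u a) (cross u b)) (sym (cross-⊝ u b a)))

  dot-flip : ∀ τ u a b → - (τ * dot u (b ⊝ a)) ≡ τ * dot u (a ⊝ b)
  dot-flip τ u a b = trans (cong (λ t → - (τ * t)) (dot-⊝ u a b))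
    (trans (solve 3 (λ τ a b → :- (τ :* (b :- a)) := τ :* (a :- b)) refl τ (dot u a) (dot u b))
      (cong (τ *_) (sym (dot-⊝ u b a))))

  sum-zero : ∀ {x y} → 0# ≤ x → 0# ≤ y → x + y ≡ 0# → x ≡ 0# × y ≡ 0#
  sum-zero         (inj₁ 0<x)  0≤y eq = ⊥-elim (pos⇒≢0 (+-pos-nonneg 0<x 0≤y) eq)
  sum-zero {y = y} (inj₂ refl) 0≤y eq = refl , trans (sym (+-identityˡ y)) eq

  lex-trans : ∀ {τ u} a b c → LexNonneg τ u (b ⊝ a) → LexNonneg τ u (c ⊝ b) → LexNonneg τ u (c ⊝ a)
  lex-trans {τ} {u} a b c (ab , ab₀) (bc , bc₀) =
    subst (0# ≤_) (cross-chain u a b c) (+-nonneg ab bc) ,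
    λ ac≡0 → let (ab≡0 , bc≡0) = sum-zero ab bc (trans (cross-chain u a b c) ac≡0) in
      subst (0# ≤_) (dot-chain τ u a b c) (+-nonneg (ab₀ ab≡0) (bc₀ bc≡0))

  lex-total : ∀ τ u a b → LexNonneg τ u (b ⊝ a) ⊎ LexNonneg τ u (a ⊝ b)
  lex-total τ u a b with pos-zero-neg (cross u (b ⊝ a))
  ... | inj₁ 0<ab = inj₁ (inj₁ 0<ab , λ ab≡0 → ⊥-elim (pos⇒≢0 0<ab ab≡0))
  ... | inj₂ (inj₂ 0<-ab) = inj₂ (inj₁ 0<ba , λ ba≡0 → ⊥-elim (pos⇒≢0 0<ba ba≡0))
    where
    0<ba : 0# < cross u (a ⊝ b)
    0<ba = subst (0# <_) (cross-flip u a b) 0<-ab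
  ... | inj₂ (inj₁ ab≡0) with nonneg-neg (τ * dot u (b ⊝ a))
  ...   | inj₁ dot≥0 = inj₁ (inj₂ (sym ab≡0) , λ _ → dot≥0)
  ...   | inj₂ 0<-dot = inj₂
            (inj₂ (trans (sym -0#≈0#) (trans (cong -_ (sym ab≡0)) (cross-flip u a b))) ,
             λ _ → inj₁ (subst (0# <_) (dot-flip τ u a b) 0<-dot))

  lex-refl : ∀ τ u a → LexNonneg τ u (a ⊝ a)
  lex-refl τ u a with lex-total τ u a a
  ... | inj₁ a≤a = a≤a
  ... | inj₂ a≤a = a≤a

  extreme-∷ : ∀ τ u b B → ∃ (Extreme τ u (b ∷ B))
  extreme-∷ τ u b [] = b , here refl , λ { (here refl) → lex-refl τ u b }
  extreme-∷ τ u b (c ∷ B) with extreme-∷ τ u c B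
  ... | m , m∈ , m-min with lex-total τ u b m
  ...   | inj₁ b≤m = b , here refl , λ
            { (here refl) → lex-refl τ u b ; (there r∈) → lex-trans b m _ b≤m (m-min r∈) }
  ...   | inj₂ m≤b = m , there m∈ , λ { (here refl) → m≤b ; (there r∈) → m-min r∈ }

  extreme-exists : ∀ τ u {B b} → b ∈ B → ∃ (Extreme τ u B)
  extreme-exists τ u {b ∷ B} _ = extreme-∷ τ u b B

  -- Two edges at the same point agree only up to a positive factor, so extremality has to survive
  -- rescaling.
  lex-∙ : ∀ {τ k u} z → 0# < k → LexNonneg τ (k ∙ u) z → LexNonneg τ u z
  lex-∙ {τ} {k} {u} z@(z₁ , z₂) 0<k (c , d) =
    *-cancelˡ-nonneg 0<k (subst (0# ≤_) (cross-∙ k u z) c) ,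
    λ uz≡0 → *-cancelˡ-nonneg 0<k (subst (0# ≤_)
      (solve 6 (λ τ k u₁ u₂ z₁ z₂ → τ :* (k :* u₁ :* z₁ :+ k :* u₂ :* z₂) := k :* (τ :* (u₁ :* z₁ :+ u₂ :* z₂)))
        refl τ k (proj₁ u) (proj₂ u) z₁ z₂)
      (d (trans (cross-∙ k u z) (trans (cong (k *_) uz≡0) (zeroʳ k)))))

  lex-antisym : ∀ {τ u} a b → ¬ τ ≡ 0# → ¬ u ≡ O →
    LexNonneg τ u (b ⊝ a) → LexNonneg τ u (a ⊝ b) → a ≡ b
  lex-antisym {τ} {u} a b τ≢0 u≢O (ab , ab₀) (ba , ba₀) = sym (begin
    b                    ≡⟨ ⊕-⊝ a b ⟨
    a ⊕ (b ⊝ a)          ≡⟨ cong (a ⊕_) difference≡O ⟩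
    a ⊕ O                ≡⟨ cong₂ _,_ (+-identityʳ _) (+-identityʳ _) ⟩
    a                    ∎)
    where
    open ≡-Reasoning
    ab≡0 : cross u (b ⊝ a) ≡ 0#
    ab≡0 = nonneg-antisym ab (subst (0# ≤_) (sym (cross-flip u a b)) ba)
    ba≡0 : cross u (a ⊝ b) ≡ 0#
    ba≡0 = trans (sym (cross-flip u a b)) (trans (cong -_ ab≡0) -0#≈0#)
    dot≡0 : dot u (b ⊝ a) ≡ 0#
    dot≡0 = *-cancelˡ-zero τ≢0 (nonneg-antisym (ab₀ ab≡0)
      (subst (0# ≤_) (sym (dot-flip τ u a b)) (ba₀ ba≡0)))
    difference≡O : b ⊝ a ≡ O
    difference≡O = let (k , eq) = cross-zero⇒multiple u (b ⊝ a) u≢O ab≡0 in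
      trans eq (trans (cong (λ t → (t * k) ∙ u) dot≡0)
      (trans (cong (_∙ u) (zeroˡ k)) (zero-∙ u)))

  extreme-unique : ∀ {τ k u B b b′} → ¬ τ ≡ 0# → ¬ u ≡ O → 0# < k →
    Extreme τ u B b → Extreme τ (k ∙ u) B b′ → b ≡ b′
  extreme-unique {b = b} {b′} τ≢0 u≢O 0<k (b∈ , b-min) (b′∈ , b′-min) =
    lex-antisym b b′ τ≢0 u≢O (b-min b′∈) (lex-∙ (b ⊝ b′) 0<k (b′-min b∈))

  cross-⊕ : ∀ u v w → cross u (v ⊕ w) ≡ cross u v + cross u w
  cross-⊕ (u₁ , u₂) (v₁ , v₂) (w₁ , w₂) =
    solve 6 (λ u₁ u₂ v₁ v₂ w₁ w₂ → X u₁ u₂ (v₁ :+ w₁) (v₂ :+ w₂) := X u₁ u₂ v₁ v₂ :+ X u₁ u₂ w₁ w₂)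
      refl u₁ u₂ v₁ v₂ w₁ w₂

  ⊝-⊕-interchange : ∀ a b a′ b′ → (a′ ⊕ b′) ⊝ (a ⊕ b) ≡ (a′ ⊝ a) ⊕ (b′ ⊝ b)
  ⊝-⊕-interchange (a₁ , a₂) (b₁ , b₂) (a₁′ , a₂′) (b₁′ , b₂′) = cong₂ _,_ (eq a₁ b₁ a₁′ b₁′) (eq a₂ b₂ a₂′ b₂′)
    where
    eq : ∀ a b a′ b′ → (a′ + b′) - (a + b) ≡ (a′ - a) + (b′ - b)
    eq = solve 4 (λ a b a′ b′ → (a′ :+ b′) :- (a :+ b) := (a′ :- a) :+ (b′ :- b)) refl

  ⊕-comm : ∀ p q → p ⊕ q ≡ q ⊕ p
  ⊕-comm p q = cong₂ _,_ (+-comm _ _) (+-comm _ _)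

  ⊕-assoc : ∀ p q r → (p ⊕ q) ⊕ r ≡ p ⊕ (q ⊕ r)
  ⊕-assoc p q r = cong₂ _,_ (+-assoc _ _ _) (+-assoc _ _ _)

  ⊕-cancelˡ : ∀ p {q r} → p ⊕ q ≡ p ⊕ r → q ≡ r
  ⊕-cancelˡ p {q} {r} eq = trans (sym (⊕-cancel-left p q)) (trans (cong (_⊝ p) eq) (⊕-cancel-left p r))

  ⊕-cancelʳ : ∀ p {q r} → q ⊕ p ≡ r ⊕ p → q ≡ r
  ⊕-cancelʳ p {q} {r} eq = ⊕-cancelˡ p (trans (⊕-comm p q) (trans eq (⊕-comm r p)))

  hull-member : ∀ {C : Point → Set} {p} → C p → InHull C p
  hull-member {C} {p} Cp = 1 , (λ _ → p) , (λ _ → 1#) , (λ _ → Cp) , (λ _ → inj₁ 0<1) ,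
    +-identityʳ 1# , coordinate (proj₁ p) , coordinate (proj₂ p)
    where
    coordinate : ∀ x → 1# * x + 0# ≡ x
    coordinate x = trans (+-identityʳ _) (*-identityˡ x)

  1≢0 : ¬ 1# ≡ 0#
  1≢0 1≡0 = 0≢1 (sym 1≡0)

  -1≢0 : ¬ - 1# ≡ 0#
  -1≢0 -1≡0 = 1≢0 (trans (sym (neg-involutive 1#)) (trans (cong -_ -1≡0) -0#≈0#))

  -- Boundary points of the sum

  module MinkowskiSum (A B : FinSet) where

    S : Point → Set
    S p = p ∈Sum A , B

    S-left : ∀ {u a b} → (∀ {r} → r ∈ A → 0# ≤ cross u (r ⊝ a)) → (∀ {r} → r ∈ B → 0# ≤ cross u (r ⊝ b)) →
      ∀ {r} → S r → 0# ≤ cross u (r ⊝ (a ⊕ b))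
    S-left {u} {a} {b} A-left B-left (a′ , b′ , a′∈ , b′∈ , refl) = subst (0# ≤_)
      (sym (trans (cong (cross u) (⊝-⊕-interchange a b a′ b′)) (cross-⊕ u (a′ ⊝ a) (b′ ⊝ b))))
      (+-nonneg (A-left a′∈) (B-left b′∈))

    -- The minimum of `cross u` over the sum is the sum of the two minima, so faces of the same
    -- direction add; a step along `u` inside A stays a step inside `S`.
    edge-⊕-extreme : ∀ {τ a b u} → Edge (_∈ A) a u → Extreme τ u B b → Edge S (a ⊕ b) u
    edge-⊕-extreme {τ} {a} {b} {u} e (b∈ , b-min) = record
      { nonzero = nonzero e
      ; start   = a , b , start e , b∈ , refl
      ; end     = a ⊕ u , b , end e , b∈ ,
          trans (⊕-assoc a b u) (trans (cong (a ⊕_) (⊕-comm b u)) (sym (⊕-assoc a u b)))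
      ; left    = S-left (left e) (λ r∈ → proj₁ (b-min r∈)) }

    extreme-⊕-edge : ∀ {τ a b u} → Extreme τ u A a → Edge (_∈ B) b u → Edge S (a ⊕ b) u
    extreme-⊕-edge {τ} {a} {b} {u} (a∈ , a-min) e = record
      { nonzero = nonzero e
      ; start   = a , b , a∈ , start e , refl
      ; end     = a , b ⊕ u , a∈ , end e , ⊕-assoc a b u
      ; left    = S-left (λ r∈ → proj₁ (a-min r∈)) (left e) }

    S-non-collinear : ∀ {b} → b ∈ B → ¬ Collinear (_∈ A) → ¬ Collinear S
    S-non-collinear {b₁ , b₂} b∈ non-collinear (α , β , c , αβ≢0 , on-line) = non-collinear
      (α , β , c - (α * b₁ + β * b₂) , αβ≢0 , λ x y a∈ → trans
        (solve 6 (λ α β x y b₁ b₂ → α :* x :+ β :* y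
            := (α :* (x :+ b₁) :+ β :* (y :+ b₂)) :- (α :* b₁ :+ β :* b₂)) refl α β x y b₁ b₂)
        (cong (λ t → t - (α * b₁ + β * b₂))
          (on-line (x + b₁) (y + b₂) ((x , y) , (b₁ , b₂) , a∈ , b∈ , refl))))

    -- Traversing ∂[A+B] counterclockwise, the side with direction u is covered by the side of A
    -- shifted by the first point of the parallel side of B, followed by the side of B shifted
    -- by the last point of the parallel side of A.
    Origin : Point ⊎ Point → Point → Set
    Origin (inj₁ a) p = Σ Point λ u → Σ Point λ b → Edge (_∈ A) a u × Extreme 1# u B b × p ≡ a ⊕ b
    Origin (inj₂ b) p = Σ Point λ u → Σ Point λ a → Extreme (- 1#) u A a × Edge (_∈ B) b u × p ≡ a ⊕ b

    origin-edge : ∀ x {p} → Origin x p → ∃ (Edge S p)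
    origin-edge (inj₁ a) (u , b , e , first , refl) = u , edge-⊕-extreme e first
    origin-edge (inj₂ b) (u , a , last , e , refl)  = u , extreme-⊕-edge last e

    -- Let p = a + b′ = a′ + b. As `b′` is first on its face, `b` is not before it, so by b - b′ = a
    -- - a′ the point `a` is not before `a′`. But `a′` is last on its face, while `a ⊕ u` lies on
    -- that face strictly after `a`.
    origins-disjoint : ¬ Collinear S → ∀ {a b p} → Origin (inj₁ a) p → Origin (inj₂ b) p → ⊥
    origins-disjoint non-collinear {a} {b} {p} (u , b′ , e , first , p≡) (v , a′ , last , f , p≡′) =
      let (k , 0<k , v≡ku) = edge-direction-unique non-collinear
            (subst (λ p → Edge S p u) (sym p≡) (edge-⊕-extreme e first))
            (subst (λ p → Edge S p v) (sym p≡′) (extreme-⊕-edge last f))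
      in too-long k 0<k (subst (λ v → Extreme (- 1#) v A a′) v≡ku last) (subst (Edge (_∈ B) b) v≡ku f)
      where
      b-b′≡a-a′ : b ⊝ b′ ≡ a ⊝ a′
      b-b′≡a-a′ = cong₂ _,_ (shift (cong proj₁ (trans (sym p≡) p≡′))) (shift (cong proj₂ (trans (sym p≡) p≡′)))
        where
        shift : ∀ {a a′ b b′} → a + b′ ≡ a′ + b → b - b′ ≡ a - a′
        shift {a} {a′} {b} {b′} eq = begin
          b - b′              ≡⟨ solve 3 (λ a′ b b′ → b :- b′ := (a′ :+ b) :- (a′ :+ b′)) refl a′ b b′ ⟩
          a′ + b - (a′ + b′)  ≡⟨ cong (λ t → t - (a′ + b′)) eq ⟨
          a + b′ - (a′ + b′)  ≡⟨ solve 3 (λ a a′ b′ → (a :+ b′) :- (a′ :+ b′) := a :- a′) refl a a′ b′ ⟩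
          a - a′              ∎
          where open ≡-Reasoning

      too-long : ∀ k → 0# < k → Extreme (- 1#) (k ∙ u) A a′ → Edge (_∈ B) b (k ∙ u) → ⊥
      too-long k 0<k (a′∈ , a′-max) f = nonneg-neg-⊥
        -- The two extremality inequalities along `u` add up to 0 ≤ -|u|².
        (subst (0# ≤_) cancel (+-nonneg (proj₂ end≥ end-cross) (proj₂ a≥ a-cross)))
        (subst (0# <_) (sym (neg-involutive _)) (dot-self-pos u (nonzero e)))
        where
        a≥ : LexNonneg 1# u (a ⊝ a′)
        a≥ = subst (LexNonneg 1# u) b-b′≡a-a′ (proj₂ first (start f))
        end≥ : LexNonneg (- 1#) u ((a ⊕ u) ⊝ a′)
        end≥ = lex-∙ ((a ⊕ u) ⊝ a′) 0<k (a′-max (end e))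
        a-cross : cross u (a ⊝ a′) ≡ 0#
        a-cross = nonneg-antisym (proj₁ a≥) (subst (0# ≤_) (sym (cross-flip u a′ a)) (left e a′∈))
        end-cross : cross u ((a ⊕ u) ⊝ a′) ≡ 0#
        end-cross = trans (sym (cross-chain u a′ a (a ⊕ u)))
          (trans (cong₂ _+_ a-cross (trans (cong (cross u) (⊕-cancel-left a u)) (cross-self u))) (+-identityʳ 0#))
        cancel : - 1# * dot u ((a ⊕ u) ⊝ a′) + 1# * dot u (a ⊝ a′) ≡ - dot u u
        cancel = begin
          - 1# * dot u ((a ⊕ u) ⊝ a′) + 1# * dot u (a ⊝ a′)
            ≡⟨ cong (λ t → t + 1# * dot u (a ⊝ a′)) (dot-chain (- 1#) u a′ a (a ⊕ u)) ⟨
          (- 1# * dot u (a ⊝ a′) + - 1# * dot u ((a ⊕ u) ⊝ a)) + 1# * dot u (a ⊝ a′)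
            ≡⟨ solve 3 (λ one d e → ((:- one) :* d :+ (:- one) :* e) :+ one :* d := :- (one :* e))
                 refl 1# (dot u (a ⊝ a′)) (dot u ((a ⊕ u) ⊝ a)) ⟩
          - (1# * dot u ((a ⊕ u) ⊝ a))
            ≡⟨ cong -_ (trans (*-identityˡ _) (cong (dot u) (⊕-cancel-left a u))) ⟩
          - dot u u ∎
          where open ≡-Reasoning

    -- The point `p` fixes the direction of `u`, the direction fixes the extreme summand, and
    -- cancelling that summand leaves the tagged point.
    origin-injective : ¬ Collinear S → ∀ {x y p} → Origin x p → Origin y p → x ≡ y
    origin-injective nc {inj₁ a} {inj₁ a′} (u , b , e , first , p≡) (v , b′ , f , first′ , p≡′) =
      let (k , 0<k , v≡ku) = edge-direction-unique nc
            (subst (λ p → Edge S p u) (sym p≡) (edge-⊕-extreme e first))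
            (subst (λ p → Edge S p v) (sym p≡′) (edge-⊕-extreme f first′))
          b≡b′ = extreme-unique 1≢0 (nonzero e) 0<k first (subst (λ v → Extreme 1# v B b′) v≡ku first′)
      in cong inj₁ (⊕-cancelʳ b (trans (sym p≡) (trans p≡′ (cong (a′ ⊕_) (sym b≡b′)))))
    origin-injective nc {inj₂ b} {inj₂ b′} (u , a , last , e , p≡) (v , a′ , last′ , f , p≡′) =
      let (k , 0<k , v≡ku) = edge-direction-unique nc
            (subst (λ p → Edge S p u) (sym p≡) (extreme-⊕-edge last e))
            (subst (λ p → Edge S p v) (sym p≡′) (extreme-⊕-edge last′ f))
          a≡a′ = extreme-unique -1≢0 (nonzero e) 0<k last (subst (λ v → Extreme (- 1#) v A a′) v≡ku last′)
      in cong inj₂ (⊕-cancelˡ a (trans (sym p≡) (trans p≡′ (cong (_⊕ b′) (sym a≡a′)))))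
    origin-injective nc {inj₁ a} {inj₂ b} x y = ⊥-elim (origins-disjoint nc x y)
    origin-injective nc {inj₂ b} {inj₁ a} x y = ⊥-elim (origins-disjoint nc y x)

    boundary-count : ∀ {a₀ b₀ m n k} → ¬ Collinear (_∈ A) → ¬ Collinear (_∈ B) → a₀ ∈ A → b₀ ∈ B →
      bEq (_∈ A) m → bEq (_∈ B) n → bEq S k → m +ℕ n ≤ℕ k
    boundary-count nA nB a₀∈ b₀∈ (as , as-unique , as↔ , refl) (bs , bs-unique , bs↔ , refl) (ss , _ , ss↔ , refl) =
      subst (_≤ℕ length ss)
        (trans (length-++ (map inj₁ as)) (cong₂ _+ℕ_ (length-map inj₁ as) (length-map inj₂ bs)))
        (pigeonhole Origin
          (Unique.++⁺ (Unique.map⁺ inj₁-injective as-unique) (Unique.map⁺ inj₂-injective bs-unique) disjoint)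
          image (origin-injective (S-non-collinear b₀∈ nA)))
      where
      disjoint : ∀ {x} → ¬ (x ∈ map inj₁ as × x ∈ map inj₂ bs)
      disjoint (x∈as , x∈bs) with ∈-map⁻ inj₁ x∈as | ∈-map⁻ inj₂ x∈bs
      ... | _ , _ , refl | _ , _ , ()
      on-boundary : ∀ x {p} → Origin x p → p ∈ ss
      on-boundary x {p} origin = let (_ , e) = origin-edge x origin in
        proj₂ (ss↔ p) (start e , hull-member {S} (start e) , edge⇒¬interior e)
      left-image : ∀ {a} → a ∈ as → ∃ λ p → p ∈ ss × Origin (inj₁ a) p
      left-image {a} a∈as =
        let (a∈A , _ , ¬interior) = proj₁ (as↔ a) a∈as
            (u , e)     = boundary-edge nA a∈A ¬interior
            (b , first) = extreme-exists 1# u b₀∈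
            origin      = u , b , e , first , refl
        in a ⊕ b , on-boundary (inj₁ a) origin , origin
      right-image : ∀ {b} → b ∈ bs → ∃ λ p → p ∈ ss × Origin (inj₂ b) p
      right-image {b} b∈bs =
        let (b∈B , _ , ¬interior) = proj₁ (bs↔ b) b∈bs
            (u , e)    = boundary-edge nB b∈B ¬interior
            (a , last) = extreme-exists (- 1#) u a₀∈
            origin     = u , a , last , e , refl
        in a ⊕ b , on-boundary (inj₂ b) origin , origin
      image : ∀ {x} → x ∈ map inj₁ as ++ map inj₂ bs → ∃ λ p → p ∈ ss × Origin x p
      image x∈ with ∈-++⁻ (map inj₁ as) x∈
      image x∈ | inj₁ x∈as with ∈-map⁻ inj₁ x∈as
      ... | a , a∈as , refl = left-image a∈as
      image x∈ | inj₂ x∈bs with ∈-map⁻ inj₂ x∈bs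
      ... | b , b∈bs , refl = right-image b∈bs

  -- Interior points of the sum

  -- The extra one in `suc m` is `a₀`, which differs from all the boundary points because it is
  -- interior.
  interior-count : ∀ {A D : Point → Set} {t a₀ m k} → (∀ {a} → A a → D (t ⊕ a)) →
    (∀ {a} → A a → InInterior D (t ⊕ a)) → A a₀ → InInterior A a₀ → bEq A m → iEq D k → suc m ≤ℕ k
  interior-count {A} {D} {t} {a₀} A⇒D A⇒int a₀∈ a₀-int (as , as-unique , as↔ , refl) (ds , _ , ds↔ , refl) =
    pigeonhole (λ a p → p ≡ t ⊕ a) (All.tabulate (λ a∈as a₀≡a → a₀∉as (subst (_∈ as) (sym a₀≡a) a∈as)) ∷ as-unique)
      (λ { (here refl) → image a₀∈ ; (there a∈as) → image (proj₁ (proj₁ (as↔ _) a∈as)) })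
      (λ p≡ p≡′ → ⊕-cancelˡ t (trans (sym p≡) p≡′))
    where
    a₀∉as : ¬ a₀ ∈ as
    a₀∉as a₀∈as = proj₂ (proj₂ (proj₁ (as↔ a₀) a₀∈as)) a₀-int
    image : ∀ {a} → A a → ∃ λ p → p ∈ ds × p ≡ t ⊕ a
    image {a} a∈ = t ⊕ a , proj₂ (ds↔ (t ⊕ a)) (A⇒D a∈ , A⇒int a∈) , refl

  interior-point : ∀ {C : Point → Set} → iEq C 1 → Σ Point λ p → C p × InInterior C p
  interior-point (p ∷ [] , _ , ps↔ , _) = p , proj₁ (ps↔ p) (here refl)

  -- From counts to square roots

  fromℕ-+ : ∀ m n → fromℕ (m +ℕ n) ≡ fromℕ m + fromℕ n
  fromℕ-+ zero    n = sym (+-identityˡ _)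
  fromℕ-+ (suc m) n = trans (cong (λ t → 1# + t) (fromℕ-+ m n)) (sym (+-assoc _ _ _))

  fromℕ-nonneg : ∀ n → 0# ≤ fromℕ n
  fromℕ-nonneg zero    = inj₂ refl
  fromℕ-nonneg (suc n) = inj₁ (+-pos-nonneg 0<1 (fromℕ-nonneg n))

  fromℕ-mono : ∀ {m n} → m ≤ℕ n → 0# ≤ fromℕ n - fromℕ m
  fromℕ-mono {m} {n} m≤n = subst (0# ≤_) (begin
      fromℕ (n ∸ m)                       ≡⟨ +-cancel-left (fromℕ m) _ ⟨
      fromℕ m + fromℕ (n ∸ m) - fromℕ m   ≡⟨ cong (λ t → t - fromℕ m) (fromℕ-+ m (n ∸ m)) ⟨
      fromℕ (m +ℕ (n ∸ m)) - fromℕ m      ≡⟨ cong (λ t → fromℕ t - fromℕ m) (ℕₚ.m+[n∸m]≡n m≤n) ⟩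
      fromℕ n - fromℕ m                   ∎)
    (fromℕ-nonneg (n ∸ m))
    where open ≡-Reasoning

  -- With `y` the larger root, (x + y)² = x² + 3y² - 2y(y - x) ≤ z²; the other bound serves the
  -- opposite case.
  sum≤-of-squares : ∀ {x y z} → 0# ≤ x → 0# ≤ y → 0# ≤ z →
    0# ≤ z * z - (x * x + x * x + x * x + y * y) →
    0# ≤ z * z - (y * y + y * y + y * y + x * x) → x + y ≤ z
  sum≤-of-squares {x} {y} {z} 0≤x 0≤y 0≤z bound-x bound-y with nonneg-neg (z - (x + y))
  ... | inj₁ 0≤z-xy = 0≤-⇒≤ 0≤z-xy
  ... | inj₂ 0<d = ⊥-elim (conclude (nonneg-neg (y - x)))
    where
    -- With d = x + y - z this product is d(d + 2z) = (x + y)² - z².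
    0<squares : 0# < - (z - (x + y)) * (- (z - (x + y)) + (z + z))
    0<squares = *-pos 0<d (+-pos-nonneg 0<d (+-nonneg 0≤z 0≤z))
    conclude : 0# ≤ y - x ⊎ 0# < - (y - x) → ⊥
    conclude (inj₁ x≤y) = pos⇒≢0
      (+-pos-nonneg (+-pos-nonneg 0<squares bound-y) (*-nonneg (+-nonneg 0≤y 0≤y) x≤y))
      (solve 3 (λ x y z → (:- (z :- (x :+ y)) :* (:- (z :- (x :+ y)) :+ (z :+ z))
            :+ (z :* z :- (y :* y :+ y :* y :+ y :* y :+ x :* x))) :+ (y :+ y) :* (y :- x) := con (+ 0))
        refl x y z)
    conclude (inj₂ y<x) = pos⇒≢0
      (+-pos-nonneg (+-pos-nonneg 0<squares bound-x) (*-nonneg (+-nonneg 0≤x 0≤x) (inj₁ y<x)))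
      (solve 3 (λ x y z → (:- (z :- (x :+ y)) :* (:- (z :- (x :+ y)) :+ (z :+ z))
            :+ (z :* z :- (x :* x :+ x :* x :+ x :* x :+ y :* y))) :+ (x :+ x) :* (:- (y :- x)) := con (+ 0))
        refl x y z)

-- Of the three copies of `a`, two come from doubling the interior count and one from the boundary;
-- doubling the 1 in `suc a` supplies the 2 that is subtracted.
triangle-count-bound : ∀ a b {i s} → suc a ≤ℕ i → a +ℕ b ≤ℕ s → a +ℕ a +ℕ a +ℕ b ≤ℕ 2 *ℕ i +ℕ s ∸ 2
triangle-count-bound a b {i} {s} a<i a+b≤s = subst (_≤ℕ 2 *ℕ i +ℕ s ∸ 2)
  (cong (_∸ 2) (Nat.solve 2 (λ a b → (Nat.con 2 Nat.:* (Nat.con 1 Nat.:+ a)) Nat.:+ (a Nat.:+ b)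
      Nat.:= Nat.con 2 Nat.:+ (a Nat.:+ a Nat.:+ a Nat.:+ b)) refl a b))
  (ℕₚ.∸-monoˡ-≤ 2 (ℕₚ.+-mono-≤ (ℕₚ.*-monoʳ-≤ 2 a<i) a+b≤s))
  where module Nat = ℕSolver.+-*-Solver

open RealField using (Carrier)
open Plane

theorem4p1 : (ℝ : RealField) →
    (A B : FinSet ℝ) →
    ¬ Collinear ℝ (_∈ A) → ¬ Collinear ℝ (_∈ B) →
    iEq ℝ (_∈ A) 1 → iEq ℝ (_∈ B) 1 →
    (bA bB bS iS : ℕ) →
    bEq ℝ (_∈ A) bA → bEq ℝ (_∈ B) bB →
    bEq ℝ (λ p → _∈Sum_,_ ℝ p A B) bS → iEq ℝ (λ p → _∈Sum_,_ ℝ p A B) iS →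
    (sA sB sS : Carrier ℝ) →
    IsSqrt ℝ sA (2 *ℕ 1 +ℕ bA ∸ 2) → IsSqrt ℝ sB (2 *ℕ 1 +ℕ bB ∸ 2) →
    IsSqrt ℝ sS (2 *ℕ iS +ℕ bS ∸ 2) →
    RealField._≤_ ℝ (RealField._+_ ℝ sA sB) sS
theorem4p1 ℝ A B nA nB iA iB bA bB bS iS bA-eq bB-eq bS-eq iS-eq sA sB sS
  (0≤sA , sA²) (0≤sB , sB²) (0≤sS , sS²) =
  -- `2 *ℕ 1 +ℕ bA ∸ 2` evaluates to `bA`, so `sA²` already says that the square of `sA` is
  -- `fromℕ ℝ bA`; likewise for B.
  sum≤-of-squares 0≤sA 0≤sB 0≤sS
    (square-bound bA bB sA² sB² (triangle-count-bound bA bB bA<iS bA+bB≤bS))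
    (square-bound bB bA sB² sA² (triangle-count-bound bB bA bB<iS (subst (_≤ℕ bS) (ℕₚ.+-comm bA bB) bA+bB≤bS)))
  where
  open RealField ℝ using (_≤_; _*_; _-_; _+_; 0#)
  open ConvexPlane ℝ
  open MinkowskiSum A B
  a₀ b₀ : Point ℝ
  a₀ = proj₁ (interior-point iA)
  b₀ = proj₁ (interior-point iB)
  a₀∈ : a₀ ∈ A
  a₀∈ = proj₁ (proj₂ (interior-point iA))
  b₀∈ : b₀ ∈ B
  b₀∈ = proj₁ (proj₂ (interior-point iB))
  a₀-interior : InInterior ℝ (_∈ A) a₀
  a₀-interior = proj₂ (proj₂ (interior-point iA))
  b₀-interior : InInterior ℝ (_∈ B) b₀
  b₀-interior = proj₂ (proj₂ (interior-point iB))
  bA+bB≤bS : bA +ℕ bB ≤ℕ bS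
  bA+bB≤bS = boundary-count nA nB a₀∈ b₀∈ bA-eq bB-eq bS-eq
  bA<iS : suc bA ≤ℕ iS
  -- The roles cross over: `b₀` is interior to [B], so each `a ⊕ b₀` is interior to the hull of the
  -- translate a + B, a subset of `S`.
  bA<iS = interior-count {t = b₀} (λ {a} a∈ → a , b₀ , a∈ , b₀∈ , ⊕-comm b₀ a)
    (λ {a} a∈ → subst (InInterior ℝ S) (⊕-comm a b₀)
      (interior-translate {_∈ B} {S} a (λ {b} b∈ → a , b , a∈ , b∈ , refl) b₀-interior))
    a₀∈ a₀-interior bA-eq iS-eq
  bB<iS : suc bB ≤ℕ iS
  bB<iS = interior-count {t = a₀} (λ {b} b∈ → a₀ , b , a₀∈ , b∈ , refl)
    (λ {b} b∈ → subst (InInterior ℝ S) (⊕-comm b a₀)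
      (interior-translate {_∈ A} {S} b (λ {a} a∈ → a , b , a∈ , b∈ , ⊕-comm b a) a₀-interior))
    b₀∈ b₀-interior bB-eq iS-eq
  square-bound : ∀ a b {x y} → x * x ≡ fromℕ ℝ a → y * y ≡ fromℕ ℝ b →
    a +ℕ a +ℕ a +ℕ b ≤ℕ 2 *ℕ iS +ℕ bS ∸ 2 →
    0# ≤ sS * sS - (x * x + x * x + x * x + y * y)
  square-bound a b {x} {y} x² y² a≤ = subst (0# ≤_)
    (cong₂ _-_ (sym sS²) (begin
      fromℕ ℝ (a +ℕ a +ℕ a +ℕ b)                           ≡⟨ fromℕ-+ (a +ℕ a +ℕ a) b ⟩
      fromℕ ℝ (a +ℕ a +ℕ a) + fromℕ ℝ b                    ≡⟨ cong (_+ fromℕ ℝ b) (fromℕ-+ (a +ℕ a) a) ⟩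
      fromℕ ℝ (a +ℕ a) + fromℕ ℝ a + fromℕ ℝ b             ≡⟨ cong (λ t → t + fromℕ ℝ a + fromℕ ℝ b) (fromℕ-+ a a) ⟩
      fromℕ ℝ a + fromℕ ℝ a + fromℕ ℝ a + fromℕ ℝ b        ≡⟨ cong₂ (λ s t → s + s + s + t) x² y² ⟨
      x * x + x * x + x * x + y * y                        ∎))
    (fromℕ-mono a≤)
    where open ≡-Reasoning
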